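{- Let $(\mathcal{U},\mathcal{F})$ be a set system (with $\mathcal{U}$ finite and membership in $\mathcal{F}$ decidable in time polynomial in $|\mathcal{U}|$) and assume that one can find in polynomial time a set $F_0\in\mathcal{F}_{\max}$. If $\mathcal{F}$ has a polynomial-time computable ordering scheme $\pi$ that is both proximity searchable and prefix-closed, then $\mathcal{F}_{\max}$ can be enumerated with polynomial delay and polynomial space.
   Context: A set system is a pair $(\mathcal{U},\mathcal{F})$ with $\mathcal{F}\subseteq 2^{\mathcal{U}}$; $\mathcal{F}_{\max}$ is the set of inclusion-wise maximal members of $\mathcal{F}$. The family $\mathcal{F}$ is not given explicitly; it is accessed through a polynomial-time membership test, and "polynomial" means polynomial in $|\mathcal{U}|$. An ordering scheme $\pi$ for $\mathcal{F}$ associates to every $F\in\mathcal{F}$ an ordering $\pi(F)=f_1,\dots,f_{|F|}$ of the elements of $F$ such that for all $0\le i<|F|$ the $i$th prefix $F^i:=\{f_1,\dots,f_i\}$ belongs to $\mathcal{F}$. For $F_1,F_2\in\mathcal{F}$ with $\pi(F_2)=f_1,\dots,f_{|F_2|}$, the $\pi$-proximity $F_1\tilde\cap F_2$ is the largest $i\le|F_2|$ such that $\{f_1,\dots,f_i\}\subseteq F_1$ (not necessarily symmetric). A polynomial-time computable function $\mathrm{Neighbours}:\mathcal{F}_{\max}\to 2^{\mathcal{F}_{\max}}$ is $\pi$-proximity searchable if for all $F_1\neq F_2$ in $\mathcal{F}_{\max}$ there is $F'\in\mathrm{Neighbours}(F_1)$ with $F'\tilde\cap F_2>F_1\tilde\cap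 F_2$. The ordering scheme $\pi$ is proximity searchable if a $\pi$-proximity searchable function exists. For $F\in\mathcal{F}$ let $F^+:=\{x\in\mathcal{U}\setminus F: F\cup\{x\}\in\mathcal{F}\}$. The ordering scheme $\pi$ is prefix-closed if there exist total orderings $<_F$ of $F^+$, one for each $F\in\mathcal{F}$, such that for every $F\in\mathcal{F}$: $\pi(F)=f_1,\dots,f_\ell$ if and only if $f_{i+1}=\min_{<_{F^i}}\big((F^i)^+\cap F\big)$ for every $0\le i<\ell$, where $F^i=\{f_1,\dots,f_i\}$. An enumeration algorithm lists every solution exactly once; it has polynomial delay if the time before the first output, between two consecutive outputs, and after the last output is polynomially bounded; it uses polynomial space if its working memory (not counting the output stream) is polynomially bounded. -}

module Defs where

open import Data.Bool.Base using (Bool; true; false)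
open import Data.Fin.Base using (Fin; toℕ)
open import Data.Fin.Subset using (Subset; _∈_; _∉_; _⊆_; _∪_; ⁅_⁆; ⋃; ∣_∣)
open import Data.Fin.Subset.Properties using (_⊆?_)
open import Data.List.Base using (List; []; _∷_; _++_; [_]; map; foldr; filter; length; lookup; take; upTo)
open import Data.List.Extrema.Nat using (max)
open import Data.List.Membership.Propositional using () renaming (_∈_ to _∈ₗ_)
open import Data.List.Relation.Unary.All using (All)
open import Data.List.Relation.Unary.Unique.Propositional using (Unique)
open import Data.Nat.Base using (ℕ; zero; suc; _+_; _*_; _⊔_; _≤_; _<_)
open import Data.Product.Base using (Σ; ∃; ∃-syntax; _×_; proj₁)
open import Data.Unit.Base using (⊤; tt)
open import Data.Vec.Base as Vec using (Vec; []; _∷_)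
open import Function.Base using (_on_)
open import Function.Bundles using (_⇔_)
open import Level using (0ℓ)
open import Relation.Binary.Core using (Rel)
open import Relation.Binary.PropositionalEquality.Core using (_≡_; _≢_)
open import Relation.Binary.Structures using (IsStrictTotalOrder)
open import Relation.Nullary.Decidable.Core using (does)
open import Relation.Unary using (Pred; Decidable; U)

------------------------------------------------------------------------
-- A machine model: a first-order language over binary trees with
-- loops, non-recursive procedure calls, and an output stream.

infixr 5 _∙_

data Tree : Set where
  leaf : Tree
  _∙_  : Tree → Tree → Tree

cells : Tree → ℕ
cells leaf    = 1
cells (s ∙ t) = suc (cells s + cells t)

Env : ℕ → Set
Env = Vec Tree

cellsᵉ : ∀ {k} → Env k → ℕ
cellsᵉ []      = 0
cellsᵉ (v ∷ ρ) = cells v + cellsᵉ ρ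

-- A `Term k` is a program with k local variables (de Bruijn indices).

data Term (k : ℕ) : Set where
  var   : Fin k → Term k
  leaf  : Term k
  _∙_   : Term k → Term k → Term k
  match : Term k → Term k → Term (2 + k) → Term k
  bind  : Term k → Term (1 + k) → Term k
  call  : Term 1 → Term k → Term k
  loop  : Term k → Term (1 + k) → Term k
  emit  : Term k → Term k

Program : Set
Program = Term 1

-- `step m` is an elementary step performed while m cells are in use.
-- It is charged m units of time, as if it swept through the whole
-- memory. With unit charges, `s ∙ s` would double the memory in constant
-- time; with these, time is polynomially related to that of a Turing
-- machine, and no run is faster than it takes to read its input.

data Event : Set where
  step : ℕ → Event
  out  : Tree → Event

Trace : Set
Trace = List Event

-- m further cells, not visible to the running term, are kept meanwhile.

hold : ℕ → Trace → Trace
hold m = map λ where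
  (step n) → step (m + n)
  (out v)  → out v

time : Trace → ℕ
time []           = 0
time (step m ∷ τ) = m + time τ
time (out _ ∷ τ)  = time τ

-- The output stream is not counted.

space : Trace → ℕ
space []           = 0
space (step m ∷ τ) = m ⊔ space τ
space (out _ ∷ τ)  = space τ

outputs : Trace → List Tree
outputs []           = []
outputs (step _ ∷ τ) = outputs τ
outputs (out v ∷ τ)  = v ∷ outputs τ

-- The times before the first output, between consecutive outputs, and
-- after the last output.

delaysFrom : ℕ → Trace → List ℕ
delaysFrom t []           = [ t ]
delaysFrom t (step m ∷ τ) = delaysFrom (t + m) τ
delaysFrom t (out _ ∷ τ)  = t ∷ delaysFrom 0 τ

delays : Trace → List ℕ
delays = delaysFrom 0

-- ρ ⊢ t ⇓ v ▹ τ: in the environment ρ, the term t has value v and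
-- trace τ.  Control constructs record no step of their own: each of
-- them evaluates at least one leaf of the syntax tree, which does.
--
-- ρ ⊢ b ↻ v ⇓ w ▹ τ: the loop with body b, when its state is v, ends in
-- w.  The body sees the state as its newest variable and returns
-- `leaf ∙ w` to stop with w, `(_ ∙ _) ∙ v′` to go on with state v′.

infix 4 _⊢_⇓_▹_ _⊢_↻_⇓_▹_

mutual

  data _⊢_⇓_▹_ {k} (ρ : Env k) : Term k → Tree → Trace → Set where

    var   : ∀ x → ρ ⊢ var x ⇓ Vec.lookup ρ x ▹ [ step (cellsᵉ ρ + cells (Vec.lookup ρ x)) ]

    leaf  : ρ ⊢ leaf ⇓ leaf ▹ [ step (cellsᵉ ρ + cells leaf) ]

    _∙_   : ∀ {s t v w σ τ} →
            ρ ⊢ s ⇓ v ▹ σ →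
            ρ ⊢ t ⇓ w ▹ τ →
            ρ ⊢ s ∙ t ⇓ v ∙ w ▹ σ ++ hold (cells v) τ ++ [ step (cellsᵉ ρ + cells (v ∙ w)) ]

    match-leaf : ∀ {s t u v σ τ} →
            ρ ⊢ s ⇓ leaf ▹ σ →
            ρ ⊢ t ⇓ v ▹ τ →
            ρ ⊢ match s t u ⇓ v ▹ σ ++ τ

    match-∙ : ∀ {s t u a b v σ τ} →
            ρ ⊢ s ⇓ a ∙ b ▹ σ →
            a ∷ b ∷ ρ ⊢ u ⇓ v ▹ τ →
            ρ ⊢ match s t u ⇓ v ▹ σ ++ τ

    bind  : ∀ {s t v w σ τ} →
            ρ ⊢ s ⇓ v ▹ σ →
            v ∷ ρ ⊢ t ⇓ w ▹ τ →
            ρ ⊢ bind s t ⇓ w ▹ σ ++ τ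

    call  : ∀ {p s v w σ τ} →
            ρ ⊢ s ⇓ v ▹ σ →
            v ∷ [] ⊢ p ⇓ w ▹ τ →
            ρ ⊢ call p s ⇓ w ▹ σ ++ hold (cellsᵉ ρ) τ

    loop  : ∀ {s b v w σ τ} →
            ρ ⊢ s ⇓ v ▹ σ →
            ρ ⊢ b ↻ v ⇓ w ▹ τ →
            ρ ⊢ loop s b ⇓ w ▹ σ ++ τ

    emit  : ∀ {s v σ} →
            ρ ⊢ s ⇓ v ▹ σ →
            ρ ⊢ emit s ⇓ leaf ▹ σ ++ [ out v ]

  data _⊢_↻_⇓_▹_ {k} (ρ : Env k) (b : Term (1 + k)) : Tree → Tree → Trace → Set where

    stop  : ∀ {v w σ} →
            v ∷ ρ ⊢ b ⇓ leaf ∙ w ▹ σ →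
            ρ ⊢ b ↻ v ⇓ w ▹ σ

    again : ∀ {v x y v′ w σ τ} →
            v ∷ ρ ⊢ b ⇓ (x ∙ y) ∙ v′ ▹ σ →
            ρ ⊢ b ↻ v′ ⇓ w ▹ τ →
            ρ ⊢ b ↻ v ⇓ w ▹ σ ++ τ

------------------------------------------------------------------------
-- Encodings

encode⊤ : ⊤ → Tree
encode⊤ tt = leaf

encodeBool : Bool → Tree
encodeBool false = leaf
encodeBool true  = leaf ∙ leaf

encodeℕ : ℕ → Tree
encodeℕ zero    = leaf
encodeℕ (suc n) = leaf ∙ encodeℕ n

encodeFin : ∀ {n} → Fin n → Tree
encodeFin x = encodeℕ (toℕ x)

encodeList : {A : Set} → (A → Tree) → List A → Tree
encodeList enc []       = leaf
encodeList enc (x ∷ xs) = enc x ∙ encodeList enc xs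

encodeSubset : ∀ {n} → Subset n → Tree
encodeSubset S = encodeList encodeBool (Vec.toList S)

------------------------------------------------------------------------
-- Polynomials with natural coefficients, constant coefficient first

Polynomial : Set
Polynomial = List ℕ

⟦_⟧ : Polynomial → ℕ → ℕ
⟦ p ⟧ n = foldr (λ a r → a + n * r) 0 p

------------------------------------------------------------------------
-- Set systems.  Polynomial time only makes sense for a class of
-- instances treated uniformly.  An instance i stands for the set system
-- (Fin (size i) , 𝓕 i) and is presented to programs as the tree
-- `code i` (a graph, say), together with the size in unary.

record SetSystems : Set₁ where
  field
    Instance : Set
    size     : Instance → ℕ
    code     : Instance → Tree
    𝓕        : ∀ i → Pred (Subset (size i)) 0ℓ

prefix : ∀ {n} → ℕ → List (Fin n) → Subset n
prefix k xs = ⋃ (map ⁅_⁆ (take k xs))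

-- xs enumerates the elements of S without repetition.

_Orders_ : ∀ {n} → List (Fin n) → Subset n → Set
xs Orders S = Unique xs × (∀ x → x ∈ₗ xs ⇔ x ∈ S)

IsMin : {A : Set} → Rel A 0ℓ → Pred A 0ℓ → Pred A 0ℓ
IsMin _≺_ P x = P x × (∀ y → P y → y ≢ x → x ≺ y)

module _ (Σs : SetSystems) where
  open SetSystems Σs

  𝓕max : ∀ i → Pred (Subset (size i)) 0ℓ
  𝓕max i S = 𝓕 i S × (∀ T → 𝓕 i T → S ⊆ T → S ≡ T)

  encodeInstance : Instance → Tree
  encodeInstance i = encodeℕ (size i) ∙ code i

  -- f is computed on the arguments satisfying D, in time polynomial in
  -- the size of the ground set; elsewhere its values are irrelevant.

  PolyTime : {A B : Instance → Set} →
             (∀ {i} → A i → Tree) → (∀ {i} → B i → Tree) →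
             (∀ i → Pred (A i) 0ℓ) → (∀ i → A i → B i) → Set
  PolyTime encA encB D f =
    Σ Program λ t → Σ Polynomial λ p →
      ∀ i a → D i a →
        ∃[ τ ] (encodeInstance i ∙ encA a) ∷ [] ⊢ t ⇓ encB (f i a) ▹ τ
             × outputs τ ≡ []
             × time τ ≤ ⟦ p ⟧ (size i)

  PolyTimeMembership : (∀ i → Decidable (𝓕 i)) → Set
  PolyTimeMembership 𝓕? =
    PolyTime encodeSubset encodeBool (λ _ → U) (λ i S → does (𝓕? i S))

  PolyTimeSolution : (∀ i → Subset (size i)) → Set
  PolyTimeSolution F₀ =
    PolyTime encode⊤ encodeSubset (λ _ → U) (λ i _ → F₀ i)

  -- Ordering schemes and neighbour functions are total for convenience;
  -- they are only constrained on 𝓕, respectively on 𝓕max.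

  Scheme : Set
  Scheme = ∀ i → Subset (size i) → List (Fin (size i))

  IsOrderingScheme : Scheme → Set
  IsOrderingScheme π = ∀ i S → 𝓕 i S →
    (π i S Orders S) × (∀ k → k < ∣ S ∣ → 𝓕 i (prefix k (π i S)))

  PolyTimeScheme : Scheme → Set
  PolyTimeScheme π = PolyTime encodeSubset (encodeList encodeFin) 𝓕 π

  proximity : Scheme → ∀ i → (F₁ F₂ : Subset (size i)) → ℕ
  proximity π i F₁ F₂ =
    max 0 (filter (λ k → prefix k (π i F₂) ⊆? F₁) (upTo (suc ∣ F₂ ∣)))

  ProximitySearchable : Scheme → Set
  ProximitySearchable π =
    Σ (∀ i → Subset (size i) → List (Subset (size i))) λ neighbours →
      PolyTime encodeSubset (encodeList encodeSubset) 𝓕max neighbours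
      × (∀ i F → 𝓕max i F → All (𝓕max i) (neighbours i F))
      × (∀ i F₁ F₂ → 𝓕max i F₁ → 𝓕max i F₂ → F₁ ≢ F₂ →
           ∃[ F′ ] F′ ∈ₗ neighbours i F₁ × proximity π i F₁ F₂ < proximity π i F′ F₂)

  _⁺ : ∀ {i} → Subset (size i) → Pred (Fin (size i)) 0ℓ
  _⁺ {i} S x = x ∉ S × 𝓕 i (S ∪ ⁅ x ⁆)

  -- `_≺_ S` is a relation on the whole ground set, of which only the
  -- restriction to S ⁺ matters.

  PrefixClosed : Scheme → Set₁
  PrefixClosed π = ∀ i →
    Σ (Subset (size i) → Rel (Fin (size i)) 0ℓ) λ _≺_ →
      (∀ S → 𝓕 i S →
         IsStrictTotalOrder {A = ∃ (_⁺ {i} S)} (_≡_ on proj₁) (_≺_ S on proj₁))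
      × (∀ S → 𝓕 i S → ∀ fs → length fs ≡ ∣ S ∣ →
           π i S ≡ fs ⇔
           (∀ (j : Fin (length fs)) → let P = prefix (toℕ j) fs in
              IsMin (_≺_ P) (λ x → (_⁺ {i} P) x × x ∈ S) (lookup fs j)))

  PolyDelayPolySpaceEnumerable : (∀ i → Pred (Subset (size i)) 0ℓ) → Set
  PolyDelayPolySpaceEnumerable 𝓢 =
    Σ Program λ t → Σ Polynomial λ p → Σ Polynomial λ q →
      ∀ i → Σ (List (Subset (size i))) λ Ss → ∃[ v ] ∃[ τ ]
        encodeInstance i ∷ [] ⊢ t ⇓ v ▹ τ
        × outputs τ ≡ map encodeSubset Ss
        × Unique Ss
        × (∀ S → S ∈ₗ Ss ⇔ 𝓢 i S)
        × All (_≤ ⟦ p ⟧ (size i)) (delays τ)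
        × space τ ≤ ⟦ q ⟧ (size i)

{-# OPTIONS --safe #-}

-- Following π F from F₀ and moving to a neighbour whenever the current
-- solution lacks the next element gives a canonical path to every
-- maximal F; the parent of F is the last solution before F on it. Let
-- the key of F be the shortest prefix of π F along which the path has
-- arrived at F. Let H be the parent of F; it contains the key of F up to
-- its last element. If π H begins with that part, then the key of H is a
-- proper prefix of the key of F. Otherwise, at the first difference,
-- prefix-closedness makes π H choose the smaller element. Either way the
-- key of H is lexicographically smaller, so that parents form a tree
-- rooted at F₀, and the children of H are among its neighbours. This tree is
-- traversed without a stack, recomputing parents and children; a
-- solution is emitted on entry at even depth and on exit at odd depth,
-- so that at most two moves in a row are silent.

module Submission where

open import Defs
open import Data.Bool.Base using (Bool; true; false; if_then_else_; not; _∧_; _∨_)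
open import Data.Bool.Properties using (if-float; ∧-identityʳ; ∧-assoc; ∧-zeroʳ; not-involutive)
import Data.Bool.Properties as Bool
open import Data.Fin using (#_)
open import Data.Fin.Base using (Fin; zero; suc; toℕ)
open import Data.Fin.Properties using (toℕ<n; _≟_)
open import Data.Fin.Subset using (Subset; _∈_; _∉_; _⊆_; ⁅_⁆; ⋃; ∣_∣)
open import Data.Fin.Subset.Properties
  using (_⊆?_; ∉⊥; ∣⊥∣≡0; Empty-unique; x∈⁅x⁆; x∈⁅y⁆⇒x≡y; x∈p∪q⁻; x∈p∪q⁺)
open import Data.List.Base using (List; []; _∷_; _++_; [_]; _ʳ++_; reverse; map; length; lookup; take; filter; upTo)
open import Data.List.Extrema.Nat using (argmax-sel; xs≤max)
open import Data.List.Membership.Propositional using () renaming (_∈_ to _∈ₗ_)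
open import Data.List.Membership.Propositional.Properties
  using (∈-∃++; ∈-++⁺ˡ; ∈-++⁺ʳ; ∈-++⁻; ∈-map⁺; ∈-filter⁺; ∈-filter⁻; ∈-upTo⁺)
open import Data.List.Properties
  using (++-identityʳ; ++-assoc; map-++; length-++; length-reverse; unfold-reverse; ∷-injective; ʳ++-defn; ʳ++-ʳ++; ++-ʳ++)
open import Data.List.Relation.Unary.Any using (here; there)
open import Data.List.Relation.Unary.All as All using (All; []; _∷_)
open import Data.List.Relation.Unary.AllPairs using ([]; _∷_)
open import Data.List.Relation.Unary.Unique.Propositional using (Unique)
open import Data.List.Relation.Unary.Unique.Propositional.Properties using (++⁺)
open import Data.Nat.Base hiding (∣_-_∣)
open import Data.Nat.Properties hiding (_≟_)
open import Data.Nat.Tactic.RingSolver using (solve-∀)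
open import Data.Product.Base using (Σ; ∃-syntax; Σ-syntax; _×_; _,_; proj₁; proj₂)
open import Data.Sum.Base using (_⊎_; inj₁; inj₂)
open import Data.Unit.Base using (⊤; tt)
open import Data.Vec.Base as Vec using (Vec; []; _∷_; here; there; _[_]≔_)
open import Data.Vec.Properties using ([]=⇒lookup; lookup⇒[]=; []≔-minimal; ≡-dec)
open import Function.Base using (_∘_; const; flip)
open import Function.Bundles using (_⇔_; mk⇔; Equivalence)
open import Induction.WellFounded using (Acc; acc)
open import Level using (0ℓ)
open import Relation.Binary.Core using (Rel)
open import Relation.Binary.Definitions using (DecidableEquality)
open import Relation.Binary.PropositionalEquality using (_≡_; _≢_; refl; sym; trans; cong; cong₂; subst; subst₂)
open import Relation.Binary.Structures using (IsStrictTotalOrder)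
open import Relation.Nullary using (¬_; contradiction; yes; no)
open import Relation.Unary using (Pred; Decidable)

-- Proximity searchability enters once: if the current solution contains the part C of `π F` read so
-- far but not the next element x, some neighbour has larger proximity to F, hence contains C and x.
-- So the current solution always contains what has been read, and at the end it contains F, which
-- is maximal. It depends only on the part read, not on F; orderings that begin alike therefore
-- share the beginning of their paths, which makes the keys of F and of its parent comparable. Two
-- keys are compared at their first difference, in the order belonging to the common prefix C, which
-- is an order only on the elements extending C. The resulting relation on keys need not be total,
-- but on finitely many sets irreflexivity and transitivity give induction in both directions. The
-- argument gives no polynomial bound on the depth of the tree, hence no stack. Programs are
-- specified over arbitrary families of inputs, so that branch conditions and loop invariants can be
-- assumed: the given programs promise nothing outside `𝓕` or `𝓕max`. As each step is charged for
-- the memory in use, bounds on time also bound sizes.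

-- Polynomial bounds

infixl 6 _+ₚ_
infixl 7 _*ₚ_

_+ₚ_ : Polynomial → Polynomial → Polynomial
[]      +ₚ q       = q
(a ∷ p) +ₚ []      = a ∷ p
(a ∷ p) +ₚ (b ∷ q) = (a + b) ∷ (p +ₚ q)

+ₚ-homo : ∀ p q n → ⟦ p +ₚ q ⟧ n ≡ ⟦ p ⟧ n + ⟦ q ⟧ n
+ₚ-homo []      q       n = refl
+ₚ-homo (a ∷ p) []      n = sym (+-identityʳ _)
+ₚ-homo (a ∷ p) (b ∷ q) n rewrite +ₚ-homo p q n = lemma a b n (⟦ p ⟧ n) (⟦ q ⟧ n)
  where
  lemma : ∀ a b n x y → a + b + n * (x + y) ≡ a + n * x + (b + n * y)
  lemma = solve-∀

scale : ℕ → Polynomial → Polynomial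
scale c = map (c *_)

scale-homo : ∀ c p n → ⟦ scale c p ⟧ n ≡ c * ⟦ p ⟧ n
scale-homo c []      n = sym (*-zeroʳ c)
scale-homo c (a ∷ p) n rewrite scale-homo c p n = lemma c a n (⟦ p ⟧ n)
  where
  lemma : ∀ c a n x → c * a + n * (c * x) ≡ c * (a + n * x)
  lemma = solve-∀

_*ₚ_ : Polynomial → Polynomial → Polynomial
[]      *ₚ q = []
(a ∷ p) *ₚ q = scale a q +ₚ (0 ∷ p *ₚ q)

*ₚ-homo : ∀ p q n → ⟦ p *ₚ q ⟧ n ≡ ⟦ p ⟧ n * ⟦ q ⟧ n
*ₚ-homo []      q n = refl
*ₚ-homo (a ∷ p) q n
  rewrite +ₚ-homo (scale a q) (0 ∷ p *ₚ q) n | scale-homo a q n | *ₚ-homo p q n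
  = lemma a n (⟦ p ⟧ n) (⟦ q ⟧ n)
  where
  lemma : ∀ a n x y → a * y + n * (x * y) ≡ (a + n * x) * y
  lemma = solve-∀

record Bounded {J : Set} (sz f : J → ℕ) : Set where
  constructor bounded
  field
    poly  : Polynomial
    bound : ∀ j → f j ≤ ⟦ poly ⟧ (sz j)

open Bounded

module _ {J : Set} {sz : J → ℕ} where

  infixl 6 _+ᵇ_
  infixl 7 _*ᵇ_
  infixr 5 _+₁ᵇ_

  _+ᵇ_ : {f g : J → ℕ} → Bounded sz f → Bounded sz g → Bounded sz (λ j → f j + g j)
  (F +ᵇ G) .poly    = F .poly +ₚ G .poly
  (F +ᵇ G) .bound j =
    ≤-trans (+-mono-≤ (F .bound j) (G .bound j)) (≤-reflexive (sym (+ₚ-homo (F .poly) (G .poly) (sz j))))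

  _*ᵇ_ : {f g : J → ℕ} → Bounded sz f → Bounded sz g → Bounded sz (λ j → f j * g j)
  (F *ᵇ G) .poly    = F .poly *ₚ G .poly
  (F *ᵇ G) .bound j =
    ≤-trans (*-mono-≤ (F .bound j) (G .bound j)) (≤-reflexive (sym (*ₚ-homo (F .poly) (G .poly) (sz j))))

  constᵇ : ∀ c → Bounded sz (const c)
  constᵇ c .poly    = c ∷ []
  constᵇ c .bound j = m≤m+n c _

  sizeᵇ : Bounded sz sz
  sizeᵇ .poly    = 0 ∷ 1 ∷ []
  sizeᵇ .bound j = ≤-reflexive (lemma (sz j))
    where
    lemma : ∀ n → n ≡ n * (1 + n * 0)
    lemma = solve-∀

  _+₁ᵇ_ : {f g : J → ℕ} → Bounded sz f → Bounded sz g → Bounded sz (λ j → suc (f j + g j))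
  F +₁ᵇ G = constᵇ 1 +ᵇ (F +ᵇ G)

  weakenᵇ : {f g : J → ℕ} → (∀ j → f j ≤ g j) → Bounded sz g → Bounded sz f
  weakenᵇ f≤g G .poly    = G .poly
  weakenᵇ f≤g G .bound j = ≤-trans (f≤g j) (G .bound j)

reindexᵇ : {I J : Set} {sz f : J → ℕ} (h : I → J) → Bounded sz f → Bounded (sz ∘ h) (f ∘ h)
reindexᵇ h F .poly    = F .poly
reindexᵇ h F .bound i = F .bound (h i)

-- Traces

time-++ : ∀ σ τ → time (σ ++ τ) ≡ time σ + time τ
time-++ []           τ = refl
time-++ (step m ∷ σ) τ rewrite time-++ σ τ = sym (+-assoc m (time σ) (time τ))
time-++ (out _ ∷ σ)  τ = time-++ σ τ

outputs-++ : ∀ σ τ → outputs (σ ++ τ) ≡ outputs σ ++ outputs τ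
outputs-++ []           τ = refl
outputs-++ (step _ ∷ σ) τ = outputs-++ σ τ
outputs-++ (out v ∷ σ)  τ = cong (v ∷_) (outputs-++ σ τ)

outputs-hold : ∀ m τ → outputs (hold m τ) ≡ outputs τ
outputs-hold m []           = refl
outputs-hold m (step _ ∷ τ) = outputs-hold m τ
outputs-hold m (out v ∷ τ)  = cong (v ∷_) (outputs-hold m τ)

steps : Trace → ℕ
steps []           = 0
steps (step _ ∷ τ) = suc (steps τ)
steps (out _ ∷ τ)  = steps τ

steps-++ : ∀ σ τ → steps (σ ++ τ) ≡ steps σ + steps τ
steps-++ []           τ = refl
steps-++ (step _ ∷ σ) τ = cong suc (steps-++ σ τ)
steps-++ (out _ ∷ σ)  τ = steps-++ σ τ

time-hold : ∀ m τ → time (hold m τ) ≡ m * steps τ + time τ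
time-hold m []           = cong (_+ 0) (sym (*-zeroʳ m))
time-hold m (step n ∷ τ) rewrite time-hold m τ = lemma m n (steps τ) (time τ)
  where
  lemma : ∀ m n s t → m + n + (m * s + t) ≡ m * (1 + s) + (n + t)
  lemma = solve-∀
time-hold m (out _ ∷ τ)  = time-hold m τ

steps-hold : ∀ m τ → steps (hold m τ) ≡ steps τ
steps-hold m []           = refl
steps-hold m (step _ ∷ τ) = cong suc (steps-hold m τ)
steps-hold m (out _ ∷ τ)  = steps-hold m τ

time≤time-hold : ∀ m τ → time τ ≤ time (hold m τ)
time≤time-hold m τ = ≤-trans (m≤n+m (time τ) _) (≤-reflexive (sym (time-hold m τ)))

1≤cells : ∀ v → 1 ≤ cells v
1≤cells leaf    = s≤s z≤n
1≤cells (_ ∙ _) = s≤s z≤n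

≤-time-++ˡ : ∀ {m} σ τ → m ≤ time σ → m ≤ time (σ ++ τ)
≤-time-++ˡ σ τ m≤ = ≤-trans m≤ (≤-trans (m≤m+n _ _) (≤-reflexive (sym (time-++ σ τ))))

≤-time-++ʳ : ∀ {m} σ τ → m ≤ time τ → m ≤ time (σ ++ τ)
≤-time-++ʳ σ τ m≤ = ≤-trans m≤ (≤-trans (m≤n+m _ _) (≤-reflexive (sym (time-++ σ τ))))

steps≤time-++ : ∀ σ τ → steps σ ≤ time σ → steps τ ≤ time τ → steps (σ ++ τ) ≤ time (σ ++ τ)
steps≤time-++ σ τ p q rewrite steps-++ σ τ | time-++ σ τ = +-mono-≤ p q

steps≤time-hold : ∀ m τ → steps τ ≤ time τ → steps (hold m τ) ≤ time (hold m τ)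
steps≤time-hold m τ p rewrite steps-hold m τ = ≤-trans p (time≤time-hold m τ)

mutual

  -- Each step is charged at least for the value it produces, which has a cell. By `time-hold`,
  -- holding m further cells then costs at most m times the running time.
  steps≤time : ∀ {k} {ρ : Env k} {t v τ} → ρ ⊢ t ⇓ v ▹ τ → steps τ ≤ time τ
  steps≤time {ρ = ρ} (var x) =
    ≤-trans (1≤cells (Vec.lookup ρ x)) (≤-trans (m≤n+m _ (cellsᵉ ρ)) (m≤m+n _ 0))
  steps≤time {ρ = ρ} leaf = ≤-trans (m≤n+m 1 (cellsᵉ ρ)) (m≤m+n _ 0)
  steps≤time {ρ = ρ} (_∙_ {v = v} {w} {σ} {τ} d e) =
    steps≤time-++ σ _ (steps≤time d)
      (steps≤time-++ (hold (cells v) τ) _ (steps≤time-hold (cells v) τ (steps≤time e))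
        (≤-trans (s≤s z≤n) (≤-trans (m≤n+m (cells (v ∙ w)) (cellsᵉ ρ)) (m≤m+n _ 0))))
  steps≤time (match-leaf {σ = σ} d e) = steps≤time-++ σ _ (steps≤time d) (steps≤time e)
  steps≤time (match-∙ {σ = σ} d e)    = steps≤time-++ σ _ (steps≤time d) (steps≤time e)
  steps≤time (bind {σ = σ} d e)       = steps≤time-++ σ _ (steps≤time d) (steps≤time e)
  steps≤time (call {σ = σ} {τ} d e)   =
    steps≤time-++ σ _ (steps≤time d) (steps≤time-hold _ τ (steps≤time e))
  steps≤time (loop {σ = σ} d e)       = steps≤time-++ σ _ (steps≤time d) (steps≤time-↻ e)
  steps≤time (emit {σ = σ} d)         = steps≤time-++ σ _ (steps≤time d) z≤n

  steps≤time-↻ : ∀ {k} {ρ : Env k} {b v w τ} → ρ ⊢ b ↻ v ⇓ w ▹ τ → steps τ ≤ time τ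
  steps≤time-↻ (stop d)            = steps≤time d
  steps≤time-↻ (again {σ = σ} d e) = steps≤time-++ σ _ (steps≤time d) (steps≤time-↻ e)

-- The leaf of the syntax tree evaluated first is evaluated in the full environment and is charged
-- for it.
env≤time : ∀ {k} {ρ : Env k} {t v τ} → ρ ⊢ t ⇓ v ▹ τ → cellsᵉ ρ ≤ time τ
env≤time (var x)                = ≤-trans (m≤m+n _ _) (m≤m+n _ 0)
env≤time leaf                   = ≤-trans (m≤m+n _ _) (m≤m+n _ 0)
env≤time (_∙_ {σ = σ} d e)      = ≤-time-++ˡ σ _ (env≤time d)
env≤time (match-leaf {σ = σ} d e) = ≤-time-++ˡ σ _ (env≤time d)
env≤time (match-∙ {σ = σ} d e)  = ≤-time-++ˡ σ _ (env≤time d)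
env≤time (bind {σ = σ} d e)     = ≤-time-++ˡ σ _ (env≤time d)
env≤time (call {σ = σ} d e)     = ≤-time-++ˡ σ _ (env≤time d)
env≤time (loop {σ = σ} d e)     = ≤-time-++ˡ σ _ (env≤time d)
env≤time (emit {σ = σ} d)       = ≤-time-++ˡ σ _ (env≤time d)

mutual

  -- The step that builds the value is charged for it. With `env≤time`, this turns time bounds into
  -- the size bounds `small-value` and `small-env`.
  value≤time : ∀ {k} {ρ : Env k} {t v τ} → ρ ⊢ t ⇓ v ▹ τ → cells v ≤ time τ
  value≤time {ρ = ρ} (var x) = ≤-trans (m≤n+m _ (cellsᵉ ρ)) (m≤m+n _ 0)
  value≤time {ρ = ρ} leaf    = ≤-trans (m≤n+m 1 (cellsᵉ ρ)) (m≤m+n _ 0)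
  value≤time {ρ = ρ} (_∙_ {v = v} {σ = σ} {τ} d e) =
    ≤-time-++ʳ σ _ (≤-time-++ʳ (hold (cells v) τ) _ (≤-trans (m≤n+m _ (cellsᵉ ρ)) (m≤m+n _ 0)))
  value≤time (match-leaf {σ = σ} d e) = ≤-time-++ʳ σ _ (value≤time e)
  value≤time (match-∙ {σ = σ} d e)    = ≤-time-++ʳ σ _ (value≤time e)
  value≤time (bind {σ = σ} d e)       = ≤-time-++ʳ σ _ (value≤time e)
  value≤time (call {σ = σ} {τ} d e)   = ≤-time-++ʳ σ _ (≤-trans (value≤time e) (time≤time-hold _ τ))
  value≤time (loop {σ = σ} d e)       = ≤-time-++ʳ σ _ (value≤time-↻ e)
  value≤time (emit {v = v} {σ = σ} d) = ≤-time-++ˡ σ _ (≤-trans (1≤cells v) (value≤time d))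

  value≤time-↻ : ∀ {k} {ρ : Env k} {b v w τ} → ρ ⊢ b ↻ v ⇓ w ▹ τ → cells w ≤ time τ
  value≤time-↻ (stop {w = w} d)    = ≤-trans (m≤n+m (cells w) 2) (value≤time d)
  value≤time-↻ (again {σ = σ} d e) = ≤-time-++ʳ σ _ (value≤time-↻ e)

-- Programs running in polynomial time, uniformly in a family of inputs

record Run {k} (ρ : Env k) (t : Term k) (v : Tree) (os : List Tree) (b : ℕ) : Set where
  constructor ran
  field
    {trace} : Trace
    eval    : ρ ⊢ t ⇓ v ▹ trace
    outs    : outputs trace ≡ os
    fast    : time trace ≤ b

open Run

-- The index set is arbitrary: an index can carry a branch condition or a loop invariant as a proof,
-- while the term stays the same for all indices.
record Emitting {J : Set} (sz : J → ℕ) {k} (ρ : J → Env k) (v : J → Tree) (os : J → List Tree) : Set where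
  constructor emitting
  field
    {limit} : J → ℕ
    term    : Term k
    run     : ∀ j → Run (ρ j) term (v j) (os j) (limit j)
    cost    : Bounded sz limit

open Emitting

Computable : {J : Set} (sz : J → ℕ) {k : ℕ} (ρ : J → Env k) (v : J → Tree) → Set
Computable sz ρ v = Emitting sz ρ v (const [])

Small : {J : Set} (sz : J → ℕ) {k : ℕ} (ρ : J → Env k) → Set
Small sz ρ = Bounded sz (cellsᵉ ∘ ρ)

lookup≤cellsᵉ : ∀ {k} (ρ : Env k) x → cells (Vec.lookup ρ x) ≤ cellsᵉ ρ
lookup≤cellsᵉ (v ∷ ρ) zero    = m≤m+n _ _
lookup≤cellsᵉ (v ∷ ρ) (suc x) = ≤-trans (lookup≤cellsᵉ ρ x) (m≤n+m _ (cells v))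

silent-++ : ∀ σ τ → outputs σ ≡ [] → outputs τ ≡ [] → outputs (σ ++ τ) ≡ []
silent-++ σ τ p q rewrite outputs-++ σ τ | p | q = refl

time-++-≤ : ∀ σ τ {b c} → time σ ≤ b → time τ ≤ c → time (σ ++ τ) ≤ b + c
time-++-≤ σ τ p q rewrite time-++ σ τ = +-mono-≤ p q

time-hold-≤ : ∀ {m b c} τ → steps τ ≤ time τ → m ≤ b → time τ ≤ c → time (hold m τ) ≤ b * c + c
time-hold-≤ {m} τ s m≤b τ≤c rewrite time-hold m τ = +-mono-≤ (*-mono-≤ m≤b (≤-trans s τ≤c)) τ≤c

module _ {J : Set} {sz : J → ℕ} {k : ℕ} {ρ : J → Env k} where

  small-env : ∀ {v os} → Emitting sz ρ v os → Small sz ρ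
  small-env C = weakenᵇ (λ j → ≤-trans (env≤time (C .run j .eval)) (C .run j .fast)) (C .cost)

  small-value : ∀ {v os} → Emitting sz ρ v os → Bounded sz (cells ∘ v)
  small-value C = weakenᵇ (λ j → ≤-trans (value≤time (C .run j .eval)) (C .run j .fast)) (C .cost)

  congᶜ : ∀ {v w : J → Tree} → (∀ j → v j ≡ w j) → Computable sz ρ v → Computable sz ρ w
  congᶜ eq C .limit = C .limit
  congᶜ eq C .term  = C .term
  congᶜ eq C .run j = subst (λ u → Run _ _ u _ _) (eq j) (C .run j)
  congᶜ eq C .cost  = C .cost

  varᶜ : Small sz ρ → ∀ x → Computable sz ρ (λ j → Vec.lookup (ρ j) x)
  varᶜ S x .limit j = cellsᵉ (ρ j) + cells (Vec.lookup (ρ j) x) + 0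
  varᶜ S x .term  = var x
  varᶜ S x .run j = ran (var x) refl ≤-refl
  varᶜ S x .cost  =
    weakenᵇ (λ j → +-monoˡ-≤ 0 (+-monoʳ-≤ (cellsᵉ (ρ j)) (lookup≤cellsᵉ (ρ j) x))) (S +ᵇ S +ᵇ constᵇ 0)

  leafᶜ : Small sz ρ → Computable sz ρ (const leaf)
  leafᶜ S .limit j = cellsᵉ (ρ j) + 1 + 0
  leafᶜ S .term  = leaf
  leafᶜ S .run j = ran leaf refl ≤-refl
  leafᶜ S .cost  = S +ᵇ constᵇ 1 +ᵇ constᵇ 0

  infixr 5 _∙ᶜ_

  _∙ᶜ_ : ∀ {v w : J → Tree} → Computable sz ρ v → Computable sz ρ w → Computable sz ρ (λ j → v j ∙ w j)
  _∙ᶜ_ C D .limit j =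
    C .limit j + (C .limit j * D .limit j + D .limit j + (C .limit j + suc (C .limit j + D .limit j) + 0))
  (C ∙ᶜ D) .term = C .term ∙ D .term
  _∙ᶜ_ {v} {w} C D .run j with C .run j in c | D .run j in d
  ... | ran {σ} x p q | ran {τ} y r s =
    ran (x ∙ y)
        (silent-++ σ _ p (silent-++ (hold (cells (v j)) τ) _ (trans (outputs-hold (cells (v j)) τ) r) refl))
        (time-++-≤ σ _ q
          (time-++-≤ (hold (cells (v j)) τ) _
            (time-hold-≤ {b = C .limit j} τ (steps≤time y) (≤-trans (value≤time x) q) s)
            (+-mono-≤ (+-mono-≤ (≤-trans (env≤time x) q)
              (s≤s (+-mono-≤ (≤-trans (value≤time x) q) (≤-trans (value≤time y) s)))) (z≤n {0}))))
  (C ∙ᶜ D) .cost =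
    C .cost +ᵇ (C .cost *ᵇ D .cost +ᵇ D .cost +ᵇ (C .cost +ᵇ (constᵇ 1 +ᵇ (C .cost +ᵇ D .cost)) +ᵇ constᵇ 0))

  -- The continuation receives the size bound of its environment, because only the run of the first
  -- part yields a bound for the new variable. The same pattern recurs in the other binding
  -- constructs.
  bindᶜ : ∀ {v w os os′} → Emitting sz ρ v os →
          (Small sz (λ j → v j ∷ ρ j) → Emitting sz (λ j → v j ∷ ρ j) w os′) →
          Emitting sz ρ w (λ j → os j ++ os′ j)
  bindᶜ {v} {w} {os} {os′} C D′ = record
    { term = bind (C .term) (D .term)
    ; run  = λ j → go (C .run j) (D .run j)
    ; cost = C .cost +ᵇ D .cost
    }
    where
    D = D′ (small-value C +ᵇ small-env C)
    go : ∀ {j} → Run (ρ j) (C .term) (v j) (os j) (C .limit j) →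
         Run (v j ∷ ρ j) (D .term) (w j) (os′ j) (D .limit j) →
         Run (ρ j) _ (w j) (os j ++ os′ j) (C .limit j + D .limit j)
    go (ran {σ} x p q) (ran {τ} y r s) =
      ran (bind x y) (trans (outputs-++ σ τ) (cong₂ _++_ p r)) (time-++-≤ σ τ q s)

  callᶜ : ∀ {v w : J → Tree} → Computable sz ρ v →
          (Small sz (λ j → v j ∷ []) → Computable sz (λ j → v j ∷ []) w) →
          Computable sz ρ w
  callᶜ {v} {w} C D′ = record
    { term = call (D .term) (C .term)
    ; run  = λ j → go (C .run j) (D .run j)
    ; cost = C .cost +ᵇ (C .cost *ᵇ D .cost +ᵇ D .cost)
    }
    where
    D = D′ (small-value C +ᵇ constᵇ 0)
    go : ∀ {j} → Run (ρ j) (C .term) (v j) [] (C .limit j) →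
         Run (v j ∷ []) (D .term) (w j) [] (D .limit j) →
         Run (ρ j) _ (w j) [] (C .limit j + (C .limit j * D .limit j + D .limit j))
    go {j} (ran {σ} x p q) (ran {τ} y r s) =
      ran (call x y) (silent-++ σ _ p (trans (outputs-hold (cellsᵉ (ρ j)) τ) r))
          (time-++-≤ σ _ q (time-hold-≤ τ (steps≤time y) (≤-trans (env≤time x) q) s))

  emitᶜ : ∀ {v} → Computable sz ρ v → Emitting sz ρ (const leaf) (λ j → [ v j ])
  emitᶜ C .limit j = C .limit j + 0
  emitᶜ C .term = emit (C .term)
  emitᶜ C .run j with C .run j
  ... | ran {σ} x p q =
    ran (emit x) (trans (outputs-++ σ _) (cong (_++ _) p)) (time-++-≤ σ _ q z≤n)
  emitᶜ C .cost = C .cost +ᵇ constᵇ 0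

  polyᵇ : ∀ p → Bounded sz (λ j → ⟦ p ⟧ (sz j))
  polyᵇ p = bounded p (λ _ → ≤-refl)

  matchᶜ : ∀ {v w os} → Computable sz ρ v →
    (let I = Σ[ j ∈ J ] v j ≡ leaf in
     Small {I} (sz ∘ proj₁) (ρ ∘ proj₁) → Emitting {I} (sz ∘ proj₁) (ρ ∘ proj₁) (w ∘ proj₁) (os ∘ proj₁)) →
    (let I = Σ[ j ∈ J ] ∃[ a ] ∃[ b ] v j ≡ a ∙ b
         ρ′ = λ (i : I) → proj₁ (proj₂ i) ∷ proj₁ (proj₂ (proj₂ i)) ∷ ρ (proj₁ i) in
     Small (sz ∘ proj₁) ρ′ → Emitting (sz ∘ proj₁) ρ′ (w ∘ proj₁) (os ∘ proj₁)) →
    Emitting sz ρ w os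
  matchᶜ {v} {w} {os} C L′ N′ = record
    { term = match (C .term) (L .term) (N .term)
    ; run  = λ j → go j (v j) refl (C .run j)
    -- The limits of the branches exist only on their subfamilies; the polynomials that bound them
    -- make sense at every index.
    ; cost = C .cost +ᵇ (polyᵇ (L .cost .poly) +ᵇ polyᵇ (N .cost .poly))
    }
    where
    L = L′ (reindexᵇ proj₁ (small-env C))
    N = N′ (weakenᵇ
      (λ { (j , a , b , eq) →
        ≤-trans (≤-reflexive (sym (+-assoc (cells a) (cells b) (cellsᵉ (ρ j)))))
                (+-monoˡ-≤ (cellsᵉ (ρ j)) (≤-trans (n≤1+n _) (≤-reflexive (cong cells (sym eq))))) })
      (reindexᵇ proj₁ (small-value C +ᵇ small-env C)))
    go : ∀ j u → v j ≡ u → Run (ρ j) (C .term) (v j) [] (C .limit j) →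
         Run (ρ j) (match (C .term) (L .term) (N .term)) (w j) (os j)
             (C .limit j + (⟦ L .cost .poly ⟧ (sz j) + ⟦ N .cost .poly ⟧ (sz j)))
    go j leaf    eq (ran {σ} x p q) with L .run (j , eq) | L .cost .bound (j , eq)
    ... | ran {τ} y r s | b =
      ran (match-leaf (subst (λ u → ρ j ⊢ _ ⇓ u ▹ σ) eq x) y)
          (trans (outputs-++ σ τ) (trans (cong (_++ outputs τ) p) r))
          (time-++-≤ σ τ q (≤-trans (≤-trans s b) (m≤m+n _ _)))
    go j (a ∙ b) eq (ran {σ} x p q) with N .run (j , a , b , eq) | N .cost .bound (j , a , b , eq)
    ... | ran {τ} y r s | bd =
      ran (match-∙ (subst (λ u → ρ j ⊢ _ ⇓ u ▹ σ) eq x) y)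
          (trans (outputs-++ σ τ) (trans (cong (_++ outputs τ) p) r))
          (time-++-≤ σ τ q (≤-trans (≤-trans s bd) (m≤n+m _ _)))

reindexᶜ : {I J : Set} {sz : J → ℕ} {k : ℕ} {ρ : J → Env k} {ρ′ : I → Env k} {v : J → Tree} {v′ : I → Tree}
  {os : J → List Tree} {os′ : I → List Tree} (h : I → J) →
  (∀ i → ρ (h i) ≡ ρ′ i) → (∀ i → v (h i) ≡ v′ i) → (∀ i → os (h i) ≡ os′ i) →
  Emitting sz ρ v os → Emitting (sz ∘ h) ρ′ v′ os′
reindexᶜ h p q r C .limit   = C .limit ∘ h
reindexᶜ h p q r C .term  = C .term
reindexᶜ h p q r C .run i = subst (λ ρ → Run ρ _ _ _ _) (p i)
  (subst₂ (λ v os → Run _ _ v os _) (q i) (r i) (C .run (h i)))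
reindexᶜ h p q r C .cost  = reindexᵇ h (C .cost)

∙-injectiveˡ : ∀ {s s′ t t′ : Tree} → s Tree.∙ t ≡ s′ ∙ t′ → s ≡ s′
∙-injectiveˡ refl = refl

∙-injectiveʳ : ∀ {s s′ t t′ : Tree} → s Tree.∙ t ≡ s′ ∙ t′ → t ≡ t′
∙-injectiveʳ refl = refl

-- For branches that cannot be taken: over an empty family any term will do.
absurdᶜ : {J : Set} {sz : J → ℕ} {k : ℕ} {ρ : J → Env k} {v : J → Tree} {os : J → List Tree} →
  ¬ J → Emitting sz ρ v os
absurdᶜ ¬j .limit _ = 0
absurdᶜ ¬j .term    = leaf
absurdᶜ ¬j .run j   = contradiction j ¬j
absurdᶜ ¬j .cost    = constᵇ 0

-- The remaining list is passed along because `scanStep` must know whether the current neighbour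
-- occurs again later.
foldlTails : {A B : Set} → (B → A → List A → B) → B → List A → B
foldlTails f b []       = b
foldlTails f b (x ∷ xs) = foldlTails f (f b x xs) xs

module _ {J : Set} {sz : J → ℕ} {k : ℕ} {ρ : J → Env k} where

  fstᶜ : ∀ {v w : J → Tree} → Computable sz ρ (λ j → v j ∙ w j) → Computable sz ρ v
  fstᶜ C = matchᶜ C (λ _ → absurdᶜ λ ())
    (λ S → congᶜ (λ (_ , _ , _ , eq) → sym (∙-injectiveˡ eq)) (varᶜ S zero))

  sndᶜ : ∀ {v w : J → Tree} → Computable sz ρ (λ j → v j ∙ w j) → Computable sz ρ w
  sndᶜ C = matchᶜ C (λ _ → absurdᶜ λ ())
    (λ S → congᶜ (λ (_ , _ , _ , eq) → sym (∙-injectiveʳ eq)) (varᶜ S (suc zero)))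

  splitᶜ : ∀ {v w u : J → Tree} {os} → Computable sz ρ (λ j → v j ∙ w j) →
    (Small sz (λ j → v j ∷ w j ∷ ρ j) → Emitting sz (λ j → v j ∷ w j ∷ ρ j) u os) →
    Emitting sz ρ u os
  splitᶜ {v} {w} C D = matchᶜ C (λ _ → absurdᶜ λ ()) (λ _ →
    reindexᶜ proj₁
      (λ (j , _ , _ , eq) → cong₂ (λ a b → a ∷ b ∷ ρ j) (∙-injectiveˡ eq) (∙-injectiveʳ eq))
      (λ _ → refl) (λ _ → refl)
      (D (weakenᵇ
        (λ j → ≤-trans (≤-reflexive (sym (+-assoc (cells (v j)) (cells (w j)) (cellsᵉ (ρ j))))) (n≤1+n _))
        (small-value C +ᵇ small-env C))))

  caseListᶜ : ∀ {A : J → Set} (enc : ∀ {j} → A j → Tree) {xs : ∀ j → List (A j)} {w os} →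
    Computable sz ρ (λ j → encodeList enc (xs j)) →
    (let I = Σ[ j ∈ J ] xs j ≡ [] in
     Small {I} (sz ∘ proj₁) (ρ ∘ proj₁) → Emitting {I} (sz ∘ proj₁) (ρ ∘ proj₁) (w ∘ proj₁) (os ∘ proj₁)) →
    (let I = Σ[ j ∈ J ] ∃[ y ] ∃[ ys ] xs j ≡ y ∷ ys
         ρ′ = λ (i : I) → enc (proj₁ (proj₂ i)) ∷ encodeList enc (proj₁ (proj₂ (proj₂ i))) ∷ ρ (proj₁ i) in
     Small (sz ∘ proj₁) ρ′ → Emitting (sz ∘ proj₁) ρ′ (w ∘ proj₁) (os ∘ proj₁)) →
    Emitting sz ρ w os
  caseListᶜ {A} enc {xs} {w} {os} C N P = matchᶜ C
    (λ S → reindexᶜ (λ (j , eq) → j , nil (xs j) eq) (λ _ → refl) (λ _ → refl) (λ _ → refl)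
      (N (reindexᵇ proj₁ (small-env C))))
    (λ _ → reindexᶜ (λ (j , _ , _ , eq) → j , ind j eq)
      (λ (j , _ , _ , eq) → envs j eq)
      (λ _ → refl) (λ _ → refl)
      (P (weakenᵇ (λ (j , y , ys , eq) →
            ≤-trans (≤-reflexive (sym (+-assoc (cells (enc y)) (cells (encodeList enc ys)) (cellsᵉ (ρ j)))))
              (+-monoˡ-≤ (cellsᵉ (ρ j))
                (≤-trans (n≤1+n _) (≤-reflexive (cong (cells ∘ encodeList enc) (sym eq))))))
          (reindexᵇ proj₁ (small-value C +ᵇ small-env C)))))
    where
    nil : ∀ {j} ys → encodeList enc ys ≡ leaf → ys ≡ ([] {A = A j})
    nil [] _ = refl
    cons : ∀ {j a b} (zs : List (A j)) → encodeList enc zs ≡ a ∙ b →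
      ∃[ y ] ∃[ ys ] zs ≡ y ∷ ys × enc y ≡ a × encodeList enc ys ≡ b
    cons (y ∷ ys) refl = y , ys , refl , refl , refl
    ind : ∀ j {a b} → encodeList enc (xs j) ≡ a ∙ b → ∃[ y ] ∃[ ys ] xs j ≡ y ∷ ys
    ind j eq = let (y , ys , p , _) = cons (xs j) eq in y , ys , p
    envs : ∀ j {a b} (eq : encodeList enc (xs j) ≡ a ∙ b) →
      enc (proj₁ (ind j eq)) ∷ encodeList enc (proj₁ (proj₂ (ind j eq))) ∷ ρ j ≡ a ∷ b ∷ ρ j
    envs j eq = let (_ , _ , _ , p , q) = cons (xs j) eq in cong₂ (λ a b → a ∷ b ∷ ρ j) p q

  trueᶜ : Small sz ρ → Computable sz ρ (const (encodeBool true))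
  trueᶜ S = leafᶜ S ∙ᶜ leafᶜ S

  falseᶜ : Small sz ρ → Computable sz ρ (const (encodeBool false))
  falseᶜ = leafᶜ

  caseBoolᶜ : ∀ {c : J → Bool} {w os} → Computable sz ρ (λ j → encodeBool (c j)) →
    (let I = Σ[ j ∈ J ] c j ≡ false in
     Small {I} (sz ∘ proj₁) (ρ ∘ proj₁) → Emitting {I} (sz ∘ proj₁) (ρ ∘ proj₁) (w ∘ proj₁) (os ∘ proj₁)) →
    (let I = Σ[ j ∈ J ] c j ≡ true
         ρ′ = λ (i : I) → leaf ∷ leaf ∷ ρ (proj₁ i) in
     Small (sz ∘ proj₁) ρ′ → Emitting (sz ∘ proj₁) ρ′ (w ∘ proj₁) (os ∘ proj₁)) →
    Emitting sz ρ w os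
  caseBoolᶜ {c} C F T = matchᶜ C
    (λ S → reindexᶜ (λ (j , eq) → j , isFalse (c j) eq) (λ _ → refl) (λ _ → refl) (λ _ → refl)
      (F (reindexᵇ proj₁ (small-env C))))
    (λ _ → reindexᶜ (λ (j , _ , _ , eq) → j , proj₁ (isTrue (c j) eq))
      (λ (j , _ , _ , eq) → let (_ , p , q) = isTrue (c j) eq in cong₂ (λ a b → a ∷ b ∷ ρ j) p q)
      (λ _ → refl) (λ _ → refl)
      (T (constᵇ 1 +ᵇ (constᵇ 1 +ᵇ reindexᵇ proj₁ (small-env C)))))
    where
    isFalse : ∀ b → encodeBool b ≡ leaf → b ≡ false
    isFalse false _ = refl
    isTrue : ∀ b {s t} → encodeBool b ≡ s ∙ t → b ≡ true × leaf ≡ s × leaf ≡ t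
    isTrue true refl = refl , refl , refl

if-cong : ∀ {A : Set} {b c} {x y : A} → b ≡ c → (if c then x else y) ≡ (if b then x else y)
if-cong refl = refl

module _ {J : Set} {sz : J → ℕ} {k : ℕ} {ρ : J → Env k} where

  -- The alternatives live in `ρ`, whereas the branches of a match live in a longer environment.
  -- Evaluating everything beforehand and choosing inside a call avoids weakening of terms; paying
  -- for both alternatives is still polynomial.
  selectᶜ : ∀ {c : J → Bool} {v w} → Computable sz ρ (λ j → encodeBool (c j)) →
    Computable sz ρ v → Computable sz ρ w → Computable sz ρ (λ j → if c j then v j else w j)
  selectᶜ {c} {v} {w} C V W = callᶜ (C ∙ᶜ V ∙ᶜ W) λ S →
    caseBoolᶜ (fstᶜ {w = λ j → v j ∙ w j} (varᶜ S zero))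
      (λ S → congᶜ {v = w ∘ proj₁} (λ (_ , eq) → if-cong eq)
        (sndᶜ {v = v ∘ proj₁} (sndᶜ {v = encodeBool ∘ c ∘ proj₁} (varᶜ S zero))))
      (λ S → congᶜ {v = v ∘ proj₁} (λ (_ , eq) → if-cong eq)
        (fstᶜ {w = w ∘ proj₁} (sndᶜ {v = encodeBool ∘ c ∘ proj₁} (varᶜ S (suc (suc zero))))))

  ifᶜ : ∀ {A : J → Set} (enc : ∀ {j} → A j → Tree) {c : J → Bool} {x y : ∀ j → A j} →
    Computable sz ρ (λ j → encodeBool (c j)) →
    Computable sz ρ (λ j → enc (x j)) → Computable sz ρ (λ j → enc (y j)) →
    Computable sz ρ (λ j → enc (if c j then x j else y j))
  ifᶜ enc {c} C X Y = congᶜ (λ j → sym (if-float enc (c j))) (selectᶜ C X Y)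

  notᶜ : ∀ {b : J → Bool} → Computable sz ρ (encodeBool ∘ b) → Computable sz ρ (encodeBool ∘ not ∘ b)
  notᶜ {b} B = congᶜ (λ j → lemma (b j)) (selectᶜ B (falseᶜ (small-env B)) (trueᶜ (small-env B)))
    where
    lemma : ∀ b → (if b then encodeBool false else encodeBool true) ≡ encodeBool (not b)
    lemma false = refl
    lemma true  = refl

  infixr 6 _∧ᶜ_
  infixr 5 _∨ᶜ_

  _∧ᶜ_ : ∀ {b c : J → Bool} → Computable sz ρ (encodeBool ∘ b) → Computable sz ρ (encodeBool ∘ c) →
         Computable sz ρ (λ j → encodeBool (b j ∧ c j))
  _∧ᶜ_ {b} {c} B C = congᶜ (λ j → lemma (b j) (c j)) (selectᶜ B C (falseᶜ (small-env B)))
    where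
    lemma : ∀ b c → (if b then encodeBool c else encodeBool false) ≡ encodeBool (b ∧ c)
    lemma false _ = refl
    lemma true  _ = refl

  _∨ᶜ_ : ∀ {b c : J → Bool} → Computable sz ρ (encodeBool ∘ b) → Computable sz ρ (encodeBool ∘ c) →
         Computable sz ρ (λ j → encodeBool (b j ∨ c j))
  _∨ᶜ_ {b} {c} B C = congᶜ (λ j → lemma (b j) (c j)) (selectᶜ B (trueᶜ (small-env B)) C)
    where
    lemma : ∀ b c → (if b then encodeBool true else encodeBool c) ≡ encodeBool (b ∨ c)
    lemma false _ = refl
    lemma true  _ = refl

  isZeroᶜ : ∀ {m : J → ℕ} → Computable sz ρ (encodeℕ ∘ m) → Computable sz ρ (λ j → encodeBool (m j ≡ᵇ 0))
  isZeroᶜ {m} M = matchᶜ M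
    (λ S → congᶜ (λ (j , eq) → zeroCase (m j) eq) (trueᶜ S))
    (λ S → congᶜ (λ (j , _ , _ , eq) → sucCase (m j) eq) (falseᶜ S))
    where
    zeroCase : ∀ m → encodeℕ m ≡ leaf → encodeBool true ≡ encodeBool (m ≡ᵇ 0)
    zeroCase zero _ = refl
    sucCase : ∀ m {s t} → encodeℕ m ≡ s ∙ t → encodeBool false ≡ encodeBool (m ≡ᵇ 0)
    sucCase (suc _) _ = refl

  predᶜ : ∀ {m : J → ℕ} → Computable sz ρ (encodeℕ ∘ m) → Computable sz ρ (encodeℕ ∘ pred ∘ m)
  predᶜ {m} M = matchᶜ M
    (λ S → congᶜ (λ (j , eq) → zeroCase (m j) eq) (leafᶜ S))
    (λ S → congᶜ (λ (j , _ , _ , eq) → sucCase (m j) eq) (varᶜ S (suc zero)))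
    where
    zeroCase : ∀ m → encodeℕ m ≡ leaf → leaf ≡ encodeℕ (pred m)
    zeroCase zero _ = refl
    sucCase : ∀ m {s t} → encodeℕ m ≡ s ∙ t → t ≡ encodeℕ (pred m)
    sucCase (suc _) refl = refl

  data Iterates {K : Set} (state result : K → Tree) : K → ℕ → Tree → Set where
    stop  : ∀ {c w} → result c ≡ leaf ∙ w → Iterates state result c 1 w
    again : ∀ {c x y c′ m w} → result c ≡ (x ∙ y) ∙ state c′ →
            Iterates state result c′ m w → Iterates state result c (suc m) w

  -- The body is bounded uniformly over all states in `K j`, so the total is the number of rounds
  -- times that bound. `K j` is to hold only states that satisfy the invariant.
  loopᶜ : {K : J → Set} (state result : ∀ {j} → K j → Tree) {c : ∀ j → K j} {m : J → ℕ} {w : J → Tree} →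
    Computable sz ρ (λ j → state (c j)) →
    Computable {Σ J K} (sz ∘ proj₁) (λ (j , c) → state c ∷ ρ j) (λ (_ , c) → result c) →
    (∀ j → Iterates (state {j}) result (c j) (m j) (w j)) →
    Bounded sz m →
    Computable sz ρ w
  loopᶜ {K} state result {c} {m} {w} C B I M = record
    { term = loop (C .term) (B .term)
    ; run  = λ j → go (C .run j) (iter (I j))
    ; cost = C .cost +ᵇ M *ᵇ polyᵇ {ρ = ρ} (B .cost .poly)
    }
    where
    Result : ∀ {j} → K j → ℕ → Tree → Set
    Result {j} c m w = ∃[ τ ] ρ j ⊢ B .term ↻ state c ⇓ w ▹ τ × outputs τ ≡ [] ×
      time τ ≤ m * ⟦ B .cost .poly ⟧ (sz j)
    iter : ∀ {j c m w} → Iterates (state {j}) result c m w → Result c m w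
    iter {j} {c} (stop {w = w} eq) with B .run (j , c) | B .cost .bound (j , c)
    ... | ran {τ} x p q | b =
      τ , stop (subst (λ u → state c ∷ ρ j ⊢ _ ⇓ u ▹ τ) eq x) , p , ≤-trans (≤-trans q b) (m≤m+n _ 0)
    iter {j} {c} (again eq I) with B .run (j , c) | B .cost .bound (j , c) | iter I
    ... | ran {σ} x p q | b | τ , y , r , s =
      σ ++ τ , again (subst (λ u → state c ∷ ρ j ⊢ _ ⇓ u ▹ σ) eq x) y , silent-++ σ τ p r ,
      time-++-≤ σ τ (≤-trans q b) s
    go : ∀ {j} → Run (ρ j) (C .term) (state (c j)) [] (C .limit j) → Result (c j) (m j) (w j) →
         Run (ρ j) (loop (C .term) (B .term)) (w j) [] (C .limit j + m j * ⟦ B .cost .poly ⟧ (sz j))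
    go (ran {σ} x p q) (τ , y , r , s) = ran (loop x y) (silent-++ σ τ p r) (time-++-≤ σ τ q s)

-- Folds over encoded lists

module Fold {J : Set} (sz : J → ℕ) {k : ℕ} (ρ : J → Env k) {A B : J → Set}
  (encA : ∀ {j} → A j → Tree) (encB : ∀ {j} → B j → Tree)
  (f : ∀ j → B j → A j → List (A j) → B j)
  (Inv : ∀ j → B j → List (A j) → Set)
  (xs : ∀ j → List (A j)) where

  record Visit : Set where
    constructor visit
    field
      at    : J
      sofar : B at
      elt   : A at
      rest  : List (A at)
      inv   : Inv at sofar (elt ∷ rest)
      part  : cells (encodeList encA (elt ∷ rest)) ≤ cells (encodeList encA (xs at))

  open Visit public

  -- Inside a fold, variable 0 is the element, 1 the remaining list, 3 the accumulator, and the
  -- outer environment starts at 5. Variables 2 and 4 are left by the taking apart of the loop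
  -- state.
  visitEnv : Visit → Env (5 + k)
  visitEnv u = encA (u .elt) ∷ encodeList encA (u .rest) ∷ encodeList encA (u .elt ∷ u .rest) ∷ encB (u .sofar) ∷
    (encodeList encA (u .elt ∷ u .rest) ∙ encB (u .sofar)) ∷ ρ (u .at)

  -- A polynomial-time step could still let the accumulator grow exponentially over the rounds.
  -- Hence its size has to be bounded in advance, for all accumulators satisfying `Inv`.
  foldᶜ : {b : ∀ j → B j} →
    Computable sz ρ (λ j → encodeList encA (xs j)) →
    Computable sz ρ (λ j → encB (b j)) →
    (∀ j → Inv j (b j) (xs j)) →
    (∀ j b x ys → Inv j b (x ∷ ys) → Inv j (f j b x ys) ys) →
    Bounded {Σ[ j ∈ J ] Σ[ b ∈ B j ] ∃[ ys ] Inv j b ys} (sz ∘ proj₁) (λ (_ , b , _) → cells (encB b)) →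
    (Small (sz ∘ at) visitEnv →
     Computable (sz ∘ at) visitEnv (λ u → encB (f _ (u .sofar) (u .elt) (u .rest)))) →
    Computable sz ρ (λ j → encB (foldlTails (f j) (b j) (xs j)))
  foldᶜ {b} C D base next acc-bound body =
    loopᶜ {K = K} state result {m = λ j → suc (length (xs j))} (C ∙ᶜ D)
      (splitᶜ {v = ysᵛ} {w = bᵛ} (varᶜ small zero) λ S →
        caseListᶜ encA {xs = λ (_ , ys , _) → ys} (varᶜ S zero)
          (λ S → congᶜ {v = λ (i , _) → leaf ∙ bᵛ i} (λ { ((j , ys , b , _) , refl) → refl })
            (leafᶜ S ∙ᶜ varᶜ S (suc zero)))
          (λ S → congᶜ
            {v = λ ((j , _ , b , _) , y , ys , _) → encodeBool true ∙ (encodeList encA ys ∙ encB (f j b y ys))}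
            (λ { (_ , _ , _ , refl) → refl })
            (trueᶜ S ∙ᶜ varᶜ S (suc zero) ∙ᶜ
              reindexᶜ enter (λ { (_ , _ , _ , refl) → refl }) (λ _ → refl) (λ _ → refl) (body small-visit))))
      (λ j → iterates j (b j) (xs j) (base j) ≤-refl)
      (weakenᵇ (λ j → length<cells (xs j)) (small-value C))
    where
    K : J → Set
    K j = Σ[ ys ∈ List (A j) ] Σ[ b ∈ B j ] Inv j b ys × cells (encodeList encA ys) ≤ cells (encodeList encA (xs j))
    state result : ∀ {j} → K j → Tree
    state (ys , b , _) = encodeList encA ys ∙ encB b
    result ([]     , b , _)     = leaf ∙ encB b
    result {j} (y ∷ ys , b , _) = encodeBool true ∙ (encodeList encA ys ∙ encB (f j b y ys))
    ysᵛ bᵛ : Σ J K → Tree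
    ysᵛ (_ , ys , _)    = encodeList encA ys
    bᵛ (_ , _ , b , _) = encB b
    small : Small (sz ∘ proj₁) (λ ((j , c) : Σ J K) → state c ∷ ρ j)
    small = weakenᵇ (λ (j , ys , b , i , le) → +-monoˡ-≤ (cellsᵉ (ρ j)) (s≤s (+-monoˡ-≤ (cells (encB b)) le)))
      (constᵇ 1 +ᵇ (reindexᵇ proj₁ (small-value C) +ᵇ reindexᵇ (λ (j , ys , b , i , le) → j , b , ys , i) acc-bound)
        +ᵇ reindexᵇ proj₁ (small-env C))
    enter : (Σ[ (j , ys , _) ∈ Σ J K ] ∃[ y ] ∃[ zs ] ys ≡ y ∷ zs) → Visit
    enter ((j , ys , b , i , le) , y , zs , eq) =
      visit j b y zs (subst (Inv j b) eq i)
        (subst (λ ys → cells (encodeList encA ys) ≤ cells (encodeList encA (xs j))) eq le)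
    small-visit : Small (sz ∘ at) visitEnv
    small-visit = weakenᵇ
      (λ u → let p = part u; e = cells (encA (u .elt)) in
        +-mono-≤ (≤-trans (m≤m+n e _) (≤-trans (n≤1+n _) p))
        (+-mono-≤ (≤-trans (m≤n+m _ e) (≤-trans (n≤1+n _) p))
        (+-mono-≤ p
        (+-monoʳ-≤ (cells (encB (u .sofar)))
        (+-monoˡ-≤ (cellsᵉ (ρ (u .at))) (s≤s (+-monoˡ-≤ (cells (encB (u .sofar))) p)))))))
      (list +ᵇ (list +ᵇ (list +ᵇ (accᵇ +ᵇ (constᵇ 1 +ᵇ (list +ᵇ accᵇ) +ᵇ reindexᵇ at (small-env C))))))
      where
      list = reindexᵇ at (small-value C)
      accᵇ = reindexᵇ (λ u → u .at , u .sofar , u .elt ∷ u .rest , u .inv) acc-bound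
    length<cells : ∀ {j} (ys : List (A j)) → suc (length ys) ≤ cells (encodeList encA ys)
    length<cells []       = ≤-refl
    length<cells (y ∷ ys) = s≤s (≤-trans (length<cells ys) (m≤n+m _ (cells (encA y))))
    iterates : ∀ j b ys i le → Iterates (state {j}) result (ys , b , i , le) (suc (length ys))
      (encB (foldlTails (f j) b ys))
    iterates j b []       i le = stop refl
    iterates j b (y ∷ ys) i le =
      again {c′ = ys , f j b y ys , next j b y ys i , ≤-trans (≤-trans (m≤n+m _ (cells (encA y))) (n≤1+n _)) le}
        refl (iterates j (f j b y ys) ys _ _)

-- Sizes of encodings, lookup and inclusion tests

cells-encodeBool : ∀ b → cells (encodeBool b) ≤ 3
cells-encodeBool false = s≤s z≤n
cells-encodeBool true  = ≤-refl

cells-encodeℕ : ∀ m → cells (encodeℕ m) ≡ 1 + 2 * m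
cells-encodeℕ zero    = refl
cells-encodeℕ (suc m) rewrite cells-encodeℕ m = lemma m
  where
  lemma : ∀ m → 1 + (1 + (1 + 2 * m)) ≡ 1 + 2 * (1 + m)
  lemma = solve-∀

cells-encodeSubset : ∀ {n} (S : Subset n) → cells (encodeSubset S) ≤ 1 + 4 * n
cells-encodeSubset []                = ≤-refl
cells-encodeSubset {suc n} (b ∷ S) =
  ≤-trans (s≤s (+-mono-≤ (cells-encodeBool b) (cells-encodeSubset S))) (≤-reflexive (lemma n))
  where
  lemma : ∀ n → 1 + (3 + (1 + 4 * n)) ≡ 1 + 4 * (1 + n)
  lemma = solve-∀

contains : ∀ {n} → List (Fin n) → Subset n → Bool
contains []       S = true
contains (x ∷ xs) S = Vec.lookup S x ∧ contains xs S

contains-fold : ∀ {n} b (xs : List (Fin n)) S →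
  foldlTails (λ b x _ → b ∧ Vec.lookup S x) b xs ≡ b ∧ contains xs S
contains-fold b []       S = sym (∧-identityʳ b)
contains-fold b (x ∷ xs) S =
  trans (contains-fold (b ∧ Vec.lookup S x) xs S) (∧-assoc b (Vec.lookup S x) (contains xs S))

-- Started at one more than the position of the wanted bit, the counter
-- reaches 0 just after that bit has been recorded.

seek : Bool × ℕ → Bool → List Bool → Bool × ℕ
seek (a , m) b _ = (if m ≡ᵇ 0 then a else b) , pred m

seek-stays : ∀ a bs → foldlTails seek (a , 0) bs ≡ (a , 0)
seek-stays a []       = refl
seek-stays a (b ∷ bs) = seek-stays a bs

seek-lookup : ∀ {n} a (S : Subset n) x →
  foldlTails seek (a , suc (toℕ x)) (Vec.toList S) ≡ (Vec.lookup S x , 0)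
seek-lookup a (b ∷ S) zero    = seek-stays b (Vec.toList S)
seek-lookup a (b ∷ S) (suc x) = seek-lookup b S x

module _ {J : Set} {sz : J → ℕ} {k : ℕ} {ρ : J → Env k} where

  subsetᵇ : (S : ∀ j → Subset (sz j)) → Bounded sz (λ j → cells (encodeSubset (S j)))
  subsetᵇ S = weakenᵇ (λ j → cells-encodeSubset (S j)) (constᵇ 1 +ᵇ constᵇ 4 *ᵇ sizeᵇ)

  boolᵇ : (b : J → Bool) → Bounded sz (λ j → cells (encodeBool (b j)))
  boolᵇ b = weakenᵇ (λ j → cells-encodeBool (b j)) (constᵇ 3)

  lookupᶜ : {S : ∀ j → Subset (sz j)} {x : ∀ j → Fin (sz j)} →
    Computable sz ρ (λ j → encodeSubset (S j)) → Computable sz ρ (λ j → encodeFin (x j)) →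
    Computable sz ρ (λ j → encodeBool (Vec.lookup (S j) (x j)))
  lookupᶜ {S} {x} CS CX = congᶜ (λ j → cong (encodeBool ∘ proj₁) (seek-lookup false (S j) (x j)))
    (fstᶜ (foldᶜ {b = λ j → false , suc (toℕ (x j))} CS
      (falseᶜ (small-env CS) ∙ᶜ (leafᶜ (small-env CS) ∙ᶜ CX))
      (λ j → toℕ<n (x j))
      (λ j (_ , m) b bs → ≤-trans (pred[n]≤n {m}))
      (weakenᵇ (λ (j , (a , m) , _ , m≤) → s≤s (+-mono-≤ (cells-encodeBool a)
          (≤-trans (≤-reflexive (cells-encodeℕ m)) (s≤s (*-monoʳ-≤ 2 m≤)))))
        (constᵇ 4 +ᵇ (constᵇ 1 +ᵇ constᵇ 2 *ᵇ sizeᵇ)))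
      (λ s →
        let a = fstᶜ (varᶜ s (# 3)); m = sndᶜ (varᶜ s (# 3)) in
        ifᶜ encodeBool (isZeroᶜ m) a (varᶜ s (# 0)) ∙ᶜ predᶜ m)))
    where
    open Fold sz ρ {λ _ → Bool} {λ _ → Bool × ℕ} encodeBool (λ (a , m) → encodeBool a ∙ encodeℕ m)
      (λ _ → seek) (λ j (_ , m) _ → m ≤ sz j) (λ j → Vec.toList (S j))

module _ {J : Set} {sz : J → ℕ} {k : ℕ} {ρ : J → Env k} where

  containsᶜ : {P : ∀ j → List (Fin (sz j))} {S : ∀ j → Subset (sz j)} →
    Computable sz ρ (λ j → encodeList encodeFin (P j)) → Computable sz ρ (λ j → encodeSubset (S j)) →
    Computable sz ρ (λ j → encodeBool (contains (P j) (S j)))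
  containsᶜ {P} {S} CP CS = congᶜ (λ j → cong encodeBool (contains-fold true (P j) (S j)))
    (callᶜ (CP ∙ᶜ CS) λ s → foldᶜ {b = λ _ → true}
      (fstᶜ (varᶜ s (# 0))) (trueᶜ s) (λ _ → tt) (λ _ _ _ _ _ → tt)
      (boolᵇ {ρ = λ _ → []} (λ (_ , b , _) → b))
      (λ s → varᶜ s (# 3) ∧ᶜ lookupᶜ (sndᶜ (varᶜ s (# 5))) (varᶜ s (# 0))))
    where
    open Fold sz (λ j → (encodeList encodeFin (P j) ∙ encodeSubset (S j)) ∷ []) {λ j → Fin (sz j)} {λ _ → Bool}
      encodeFin encodeBool (λ j b x _ → b ∧ Vec.lookup (S j) x) (λ _ _ _ → ⊤) P

-- Space and delays of composed traces

space≤time : ∀ τ → space τ ≤ time τ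
space≤time []           = z≤n
space≤time (step m ∷ τ) = ⊔-lub (m≤m+n m _) (≤-trans (space≤time τ) (m≤n+m _ m))
space≤time (out _ ∷ τ)  = space≤time τ

space-++ : ∀ σ τ {b} → space σ ≤ b → space τ ≤ b → space (σ ++ τ) ≤ b
space-++ []           τ p q = q
space-++ (step m ∷ σ) τ p q = ⊔-lub (≤-trans (m≤m⊔n m _) p) (space-++ σ τ (≤-trans (m≤n⊔m m _) p) q)
space-++ (out _ ∷ σ)  τ p q = space-++ σ τ p q

delays-silent : ∀ t σ τ → outputs σ ≡ [] → delaysFrom t (σ ++ τ) ≡ delaysFrom (t + time σ) τ
delays-silent t []           τ _ = cong (λ t → delaysFrom t τ) (sym (+-identityʳ t))
delays-silent t (step m ∷ σ) τ e rewrite sym (+-assoc t m (time σ)) = delays-silent (t + m) σ τ e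

delays-++ : ∀ {t c D} σ τ → t + time σ ≤ c → c ≤ D →
  (∀ t′ → t′ ≤ c → All (_≤ D) (delaysFrom t′ τ)) → All (_≤ D) (delaysFrom t (σ ++ τ))
delays-++ {t} []           τ t≤c c≤D rest = rest t (≤-trans (m≤m+n t 0) t≤c)
delays-++ {t} (step m ∷ σ) τ t≤c c≤D rest =
  delays-++ σ τ (≤-trans (≤-reflexive (+-assoc t m (time σ))) t≤c) c≤D rest
delays-++ {t} (out _ ∷ σ)  τ t≤c c≤D rest =
  ≤-trans (≤-trans (m≤m+n t (time σ)) t≤c) c≤D ∷ delays-++ σ τ (≤-trans (m≤n+m (time σ) t) t≤c) c≤D rest

-- An output inside σ resets the clock, so the waiting time t accumulated before σ does not carry
-- over to τ. Delay bounds can thus start afresh at every emitting step.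
delays-reset : ∀ {t D} σ τ → outputs σ ≢ [] → t + time σ ≤ D →
  (∀ t′ → t′ ≤ time σ → All (_≤ D) (delaysFrom t′ τ)) → All (_≤ D) (delaysFrom t (σ ++ τ))
delays-reset [] τ o _ _ = contradiction refl o
delays-reset {t} (step m ∷ σ) τ o t≤D rest =
  delays-reset σ τ o (≤-trans (≤-reflexive (+-assoc t m (time σ))) t≤D)
    (λ t′ t′≤ → rest t′ (≤-trans t′≤ (m≤n+m _ m)))
delays-reset {t} (out _ ∷ σ) τ o t≤D rest =
  ≤-trans (m≤m+n t (time σ)) t≤D ∷ delays-++ {0} σ τ ≤-refl (≤-trans (m≤n+m _ t) t≤D) rest

-- Canonical path, parents and traversal as plain functions

-- Prefixes P of π F are stored in reverse.

module Search {n} (F₀ : Subset n) (π : Subset n → List (Fin n)) (neighbours : Subset n → List (Subset n)) where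

  -- On solutions, this is equality.
  same : Subset n → Subset n → Bool
  same S T = contains (π S) T

  pickStep : List (Fin n) → Subset n → Subset n → List (Subset n) → Subset n
  pickStep P G F _ = if contains P F then F else G

  -- The last neighbour containing P is taken, but any deterministic choice would serve. Keeping `G`
  -- is a default that does not occur on canonical paths, by `picked`.
  pick : Subset n → List (Fin n) → Subset n
  pick G P = foldlTails (pickStep P) G (neighbours G)

  -- The components are the current solution, the one before the latest move, and the part already
  -- read.
  walkStep : Subset n × Subset n × List (Fin n) → Fin n → List (Fin n) → Subset n × Subset n × List (Fin n)
  walkStep (G , H , P) x _ = if Vec.lookup G x then (G , H , x ∷ P) else (pick G (x ∷ P) , G , x ∷ P)

  parent : Subset n → Subset n
  parent F = proj₁ (proj₂ (foldlTails walkStep (F₀ , F₀ , []) (π F)))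

  -- The walk to `F₀` never moves, so by the default in `parent` the root is its own parent; it must
  -- be excluded here to keep the tree acyclic.
  isChild : Subset n → Subset n → Bool
  isChild H F = not (same F F₀) ∧ same H (parent F)

  member : Subset n → List (Subset n) → Bool
  member F = foldlTails (λ b G _ → b ∨ same F G) false

  -- Neighbours may be listed repeatedly; only last occurrences count.
  scanStep : Subset n → Subset n → Bool × Bool × Subset n → Subset n → List (Subset n) → Bool × Bool × Subset n
  scanStep H C (skipping , found , S) F Fs =
    if skipping then (not (same C F ∧ not (member F Fs)) , found , S)
    else if (isChild H F ∧ not (member F Fs)) ∧ not found then (false , true , F)
    else (false , found , S)

  scan : Subset n → Bool → Subset n → Bool × Subset n
  scan H skipping C = proj₂ (foldlTails (scanStep H C) (skipping , false , H) (neighbours H))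

  -- (H , odd depth , returning , C): the traversal is at H, and when
  -- returning it has just finished the subtree of C.
  State : Set
  State = Subset n × Bool × Bool × Subset n

  -- A node is exited in the state in which `scan` finds no further child, and entered in the state
  -- that is not returning; for a childless node these are the same state.
  emits : State → Bool
  emits (H , odd , returning , C) = if odd then not (proj₁ (scan H returning C)) else not returning

  continues : State → Bool
  continues (H , odd , returning , C) = proj₁ (scan H returning C) ∨ not (same H F₀)

  succ : State → State
  succ (H , odd , returning , C) =
    -- On entry the last component is ignored by `scan`. `H` is put there as a dummy because it is
    -- known to lie in the family.
    if proj₁ (scan H returning C) then (proj₂ (scan H returning C) , not odd , false , H)
    else (parent H , not odd , true , H)

  encodeState : State → Tree
  encodeState (H , odd , returning , C) = encodeSubset H ∙ encodeBool odd ∙ encodeBool returning ∙ encodeSubset C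

  emitted : State → List (Subset n)
  emitted s = if emits s then [ proj₁ s ] else []

  -- A derivation is a terminating run together with its output. It separates the cost of a run,
  -- settled in `Programs`, from its existence and its output, settled in `Canonical`.
  data Traverses : State → List (Subset n) → Set where
    halt : ∀ {s} → continues s ≡ false → Traverses s (emitted s)
    move : ∀ {s L} → continues s ≡ true → Traverses (succ s) L → Traverses s (emitted s ++ L)

-- Polynomial-time programs for the search

module Programs (Σs : SetSystems)
  (F₀ : ∀ i → Subset (SetSystems.size Σs i)) (F₀-max : ∀ i → 𝓕max Σs i (F₀ i)) (F₀-poly : PolyTimeSolution Σs F₀)
  (π : Scheme Σs) (π-poly : PolyTimeScheme Σs π)
  (neighbours : ∀ i → Subset (SetSystems.size Σs i) → List (Subset (SetSystems.size Σs i)))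
  (neighbours-poly : PolyTime Σs encodeSubset (encodeList encodeSubset) (𝓕max Σs) neighbours)
  (neighbours-max : ∀ i F → 𝓕max Σs i F → All (𝓕max Σs i) (neighbours i F)) where

  open SetSystems Σs
  open module S i = Search (F₀ i) (π i) (neighbours i)

  pickStep-max : ∀ {i P G} Fs → 𝓕max Σs i G → All (𝓕max Σs i) Fs → 𝓕max Σs i (foldlTails (pickStep i P) G Fs)
  pickStep-max {P = P} []       Gm []         = Gm
  pickStep-max {P = P} (F ∷ Fs) Gm (Fm ∷ Fsm) with contains P F
  ... | true  = pickStep-max {P = P} Fs Fm Fsm
  ... | false = pickStep-max {P = P} Fs Gm Fsm

  pick-max : ∀ {i G} P → 𝓕max Σs i G → 𝓕max Σs i (pick i G P)
  pick-max {i} {G} P Gm = pickStep-max {P = P} (neighbours i G) Gm (neighbours-max i G Gm)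

  private
    variable
      J    : Set
      inst : J → Instance
      k    : ℕ
      ρ    : J → Env k

  Subsets : (J → Instance) → Set
  Subsets inst = ∀ j → Subset (size (inst j))

  Words : (J → Instance) → Set
  Words inst = ∀ j → List (Fin (size (inst j)))

  Encoded : (inst : J → Instance) (ρ : J → Env k) → Set
  Encoded inst ρ = Computable (size ∘ inst) ρ (λ j → encodeInstance Σs (inst j))

  applyᶜ : {A B : Instance → Set} (encA : ∀ {i} → A i → Tree) (encB : ∀ {i} → B i → Tree)
    {D : ∀ i → Pred (A i) 0ℓ} (f : ∀ i → A i → B i) → PolyTime Σs encA encB D f →
    (a : ∀ j → A (inst j)) → (∀ j → D (inst j) (a j)) →
    Encoded inst ρ → Computable (size ∘ inst) ρ (λ j → encA (a j)) →
    Computable (size ∘ inst) ρ (λ j → encB (f (inst j) (a j)))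
  applyᶜ {inst = inst} encA encB f (t , p , ok) a d I C = callᶜ (I ∙ᶜ C) λ _ → record
    { term = t
    ; run  = λ j → let (_ , x , q , r) = ok (inst j) (a j) (d j) in ran x q r
    ; cost = bounded p (λ _ → ≤-refl)
    }

  startᶜ : Encoded inst ρ → Computable (size ∘ inst) ρ (λ j → encodeSubset (F₀ (inst j)))
  startᶜ I = applyᶜ encode⊤ encodeSubset (λ i _ → F₀ i) F₀-poly (λ _ → tt) (λ _ → tt) I (leafᶜ (small-env I))

  orderᶜ : {S : Subsets inst} → (∀ j → 𝓕 (inst j) (S j)) → Encoded inst ρ →
    Computable (size ∘ inst) ρ (λ j → encodeSubset (S j)) →
    Computable (size ∘ inst) ρ (λ j → encodeList encodeFin (π (inst j) (S j)))
  orderᶜ {S = S} = applyᶜ encodeSubset (encodeList encodeFin) π π-poly S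

  neighboursᶜ : {S : Subsets inst} → (∀ j → 𝓕max Σs (inst j) (S j)) → Encoded inst ρ →
    Computable (size ∘ inst) ρ (λ j → encodeSubset (S j)) →
    Computable (size ∘ inst) ρ (λ j → encodeList encodeSubset (neighbours (inst j) (S j)))
  neighboursᶜ {S = S} = applyᶜ encodeSubset (encodeList encodeSubset) neighbours neighbours-poly S

  sameᶜ : {S T : Subsets inst} → (∀ j → 𝓕 (inst j) (S j)) → Encoded inst ρ →
    Computable (size ∘ inst) ρ (λ j → encodeSubset (S j)) →
    Computable (size ∘ inst) ρ (λ j → encodeSubset (T j)) →
    Computable (size ∘ inst) ρ (λ j → encodeBool (same (inst j) (S j) (T j)))
  sameᶜ {inst = inst} {S = S} {T} d I CS CT = containsᶜ {P = λ j → π (inst j) (S j)} {T} (orderᶜ d I CS) CT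

  pickᶜ : {G : Subsets inst} {P : Words inst} → (∀ j → 𝓕max Σs (inst j) (G j)) → Encoded inst ρ →
    Computable (size ∘ inst) ρ (λ j → encodeSubset (G j)) →
    Computable (size ∘ inst) ρ (λ j → encodeList encodeFin (P j)) →
    Computable (size ∘ inst) ρ (λ j → encodeSubset (pick (inst j) (G j) (P j)))
  pickᶜ {inst = inst} {G = G} {P} Gm I CG CP = callᶜ (I ∙ᶜ CG ∙ᶜ CP) λ s → let v = varᶜ s (# 0) in
    foldᶜ {b = G} (neighboursᶜ Gm (fstᶜ v) (fstᶜ (sndᶜ v))) (fstᶜ (sndᶜ v))
      (λ _ → tt) (λ _ _ _ _ _ → tt) (subsetᵇ {ρ = λ _ → []} (λ (_ , F , _) → F))
      (λ s → ifᶜ encodeSubset (containsᶜ (sndᶜ (sndᶜ (varᶜ s (# 5)))) (varᶜ s (# 0))) (varᶜ s (# 0)) (varᶜ s (# 3)))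
    where
    open Fold (size ∘ inst)
      (λ j → (encodeInstance Σs (inst j) ∙ encodeSubset (G j) ∙ encodeList encodeFin (P j)) ∷ [])
      {λ j → Subset (size (inst j))} {λ j → Subset (size (inst j))} encodeSubset encodeSubset
      (λ j → pickStep (inst j) (P j)) (λ _ _ _ → ⊤) (λ j → neighbours (inst j) (G j))

  memberᶜ : {F : Subsets inst} {Fs : ∀ j → List (Subset (size (inst j)))} →
    (∀ j → 𝓕 (inst j) (F j)) → Encoded inst ρ →
    Computable (size ∘ inst) ρ (λ j → encodeSubset (F j)) →
    Computable (size ∘ inst) ρ (λ j → encodeList encodeSubset (Fs j)) →
    Computable (size ∘ inst) ρ (λ j → encodeBool (member (inst j) (F j) (Fs j)))
  memberᶜ {inst = inst} {F = F} {Fs} d I CF CFs = callᶜ (I ∙ᶜ CF ∙ᶜ CFs) λ s → let v = varᶜ s (# 0) in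
    foldᶜ {b = λ _ → false} (sndᶜ (sndᶜ v)) (falseᶜ s)
      (λ _ → tt) (λ _ _ _ _ _ → tt) (boolᵇ {ρ = λ _ → []} (λ (_ , b , _) → b))
      (λ s → let v = varᶜ s (# 5) in
        varᶜ s (# 3) ∨ᶜ sameᶜ (λ u → d (u .at)) (fstᶜ v) (fstᶜ (sndᶜ v)) (varᶜ s (# 0)))
    where
    open Fold (size ∘ inst)
      (λ j → (encodeInstance Σs (inst j) ∙ encodeSubset (F j) ∙ encodeList encodeSubset (Fs j)) ∷ [])
      {λ j → Subset (size (inst j))} {λ _ → Bool} encodeSubset encodeBool
      (λ j b G _ → b ∨ same (inst j) (F j) G) (λ _ _ _ → ⊤) Fs

  parentᶜ : {F : Subsets inst} → (∀ j → 𝓕 (inst j) (F j)) → Encoded inst ρ →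
    Computable (size ∘ inst) ρ (λ j → encodeSubset (F j)) →
    Computable (size ∘ inst) ρ (λ j → encodeSubset (parent (inst j) (F j)))
  parentᶜ {inst = inst} {F = F} d I CF = callᶜ (I ∙ᶜ CF) λ s →
    let v = varᶜ s (# 0); w = orderᶜ d (fstᶜ v) (sndᶜ v) in
    fstᶜ (sndᶜ (foldᶜ {b = λ j → F₀ (inst j) , F₀ (inst j) , []} w
      (startᶜ (fstᶜ v) ∙ᶜ startᶜ (fstᶜ v) ∙ᶜ leafᶜ s)
      (λ j → F₀-max (inst j) , ≤-refl) next
      (subsetᵇ {ρ = λ _ → []} (λ (_ , (G , _) , _) → G) +₁ᵇ
        (subsetᵇ {ρ = λ _ → []} (λ (_ , (_ , H , _) , _) → H) +₁ᵇ
          weakenᵇ (λ (j , (_ , _ , P) , ys , _ , le) → ≤-trans (m≤m+n _ _) le)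
            (constᵇ 1 +ᵇ reindexᵇ proj₁ (small-value w))))
      (λ s → let i = fstᶜ (varᶜ s (# 5)); x = varᶜ s (# 0); a = varᶜ s (# 3)
                 G = fstᶜ a; P = x ∙ᶜ sndᶜ (sndᶜ a) in
        ifᶜ encTriple (lookupᶜ G x) (G ∙ᶜ fstᶜ (sndᶜ a) ∙ᶜ P)
          (pickᶜ {P = λ u → u .elt ∷ proj₂ (proj₂ (u .sofar))} (λ u → proj₁ (u .inv)) i G P ∙ᶜ G ∙ᶜ P))))
    where
    encTriple : ∀ {j} → Subset (size (inst j)) × Subset (size (inst j)) × List (Fin (size (inst j))) → Tree
    encTriple (G , H , P) = encodeSubset G ∙ encodeSubset H ∙ encodeList encodeFin P
    Inv : ∀ j → Subset (size (inst j)) × Subset (size (inst j)) × List (Fin (size (inst j))) →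
      List (Fin (size (inst j))) → Set
    Inv j (G , _ , P) ys = 𝓕max Σs (inst j) G ×
      cells (encodeList encodeFin P) + cells (encodeList encodeFin ys) ≤
      1 + cells (encodeList encodeFin (π (inst j) (F j)))
    shift : ∀ x p y {b} → p + suc (x + y) ≤ b → suc (x + p) + y ≤ b
    shift x p y = ≤-trans (≤-reflexive (lemma x p y))
      where
      lemma : ∀ x p y → suc (x + p) + y ≡ p + suc (x + y)
      lemma = solve-∀
    next : ∀ j b x ys → Inv j b (x ∷ ys) → Inv j (walkStep (inst j) b x ys) ys
    next j (G , H , P) x ys (Gm , le)
      with Vec.lookup G x
         | shift (cells (encodeFin x)) (cells (encodeList encodeFin P)) (cells (encodeList encodeFin ys)) le
    ... | true  | le′ = Gm , le′
    ... | false | le′ = pick-max (x ∷ P) Gm , le′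
    open Fold (size ∘ inst) (λ j → (encodeInstance Σs (inst j) ∙ encodeSubset (F j)) ∷ [])
      {λ j → Fin (size (inst j))}
      {λ j → Subset (size (inst j)) × Subset (size (inst j)) × List (Fin (size (inst j)))}
      encodeFin encTriple
      (λ j → walkStep (inst j)) Inv (λ j → π (inst j) (F j))

  isChildᶜ : {H F : Subsets inst} → (∀ j → 𝓕 (inst j) (H j)) → (∀ j → 𝓕 (inst j) (F j)) → Encoded inst ρ →
    Computable (size ∘ inst) ρ (λ j → encodeSubset (H j)) →
    Computable (size ∘ inst) ρ (λ j → encodeSubset (F j)) →
    Computable (size ∘ inst) ρ (λ j → encodeBool (isChild (inst j) (H j) (F j)))
  isChildᶜ dH dF I CH CF = notᶜ (sameᶜ dF I CF (startᶜ I)) ∧ᶜ sameᶜ dH I CH (parentᶜ dF I CF)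

  scanᶜ : {H C : Subsets inst} {r : ∀ j → Bool} → (∀ j → 𝓕max Σs (inst j) (H j)) → (∀ j → 𝓕 (inst j) (C j)) →
    Encoded inst ρ →
    Computable (size ∘ inst) ρ (λ j → encodeSubset (H j)) →
    Computable (size ∘ inst) ρ (λ j → encodeBool (r j)) →
    Computable (size ∘ inst) ρ (λ j → encodeSubset (C j)) →
    Computable (size ∘ inst) ρ (λ j → let (found , S) = scan (inst j) (H j) (r j) (C j) in
      encodeBool found ∙ encodeSubset S)
  scanᶜ {inst = inst} {H = H} {C} {r} Hm dC I CH CR CC = callᶜ (I ∙ᶜ CH ∙ᶜ CR ∙ᶜ CC) λ s →
    let v = varᶜ s (# 0); h = fstᶜ (sndᶜ v) in
    sndᶜ (foldᶜ {b = λ j → r j , false , H j} (neighboursᶜ Hm (fstᶜ v) h)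
      (fstᶜ (sndᶜ (sndᶜ v)) ∙ᶜ falseᶜ s ∙ᶜ h)
      (λ j → neighbours-max (inst j) (H j) (Hm j)) (λ { _ _ _ _ (_ ∷ Fsm) → Fsm })
      (boolᵇ {ρ = λ _ → []} (λ (_ , (b , _) , _) → b) +₁ᵇ
        (boolᵇ {ρ = λ _ → []} (λ (_ , (_ , b , _) , _) → b) +₁ᵇ
          subsetᵇ {ρ = λ _ → []} (λ (_ , (_ , _ , S) , _) → S)))
      (λ s → let v = varᶜ s (# 5); i = fstᶜ v; x = varᶜ s (# 0); a = varᶜ s (# 3)
                 fresh = notᶜ (memberᶜ {Fs = λ u → u .rest} (λ u → head-𝓕 (u .inv)) i x (varᶜ s (# 1)))
                 found = fstᶜ (sndᶜ a); S = sndᶜ (sndᶜ a) in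
        ifᶜ encTriple (fstᶜ a)
          (notᶜ (sameᶜ (λ u → dC (u .at)) i (sndᶜ (sndᶜ (sndᶜ v))) x ∧ᶜ fresh) ∙ᶜ found ∙ᶜ S)
          (ifᶜ encTriple
            ((isChildᶜ (λ u → proj₁ (Hm (u .at))) (λ u → head-𝓕 (u .inv)) i (fstᶜ (sndᶜ v)) x ∧ᶜ fresh)
              ∧ᶜ notᶜ found)
            (falseᶜ s ∙ᶜ trueᶜ s ∙ᶜ x) (falseᶜ s ∙ᶜ found ∙ᶜ S))))
    where
    head-𝓕 : ∀ {i F Fs} → All (𝓕max Σs i) (F ∷ Fs) → 𝓕 i F
    head-𝓕 ((d , _) ∷ _) = d
    encTriple : ∀ {j} → Bool × Bool × Subset (size (inst j)) → Tree
    encTriple (w , f , S) = encodeBool w ∙ encodeBool f ∙ encodeSubset S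
    open Fold (size ∘ inst)
      (λ j → (encodeInstance Σs (inst j) ∙ encodeSubset (H j) ∙ encodeBool (r j) ∙ encodeSubset (C j)) ∷ [])
      {λ j → Subset (size (inst j))}
      {λ j → Bool × Bool × Subset (size (inst j))}
      encodeSubset encTriple
      (λ j → scanStep (inst j) (H j) (C j)) (λ j _ Fs → All (𝓕max Σs (inst j)) Fs)
      (λ j → neighbours (inst j) (H j))

  -- The states on which the given programs are guaranteed to work: neighbours are computed for H,
  -- and the comparison with C uses the ordering of C.
  record Valid : Set where
    constructor valid
    field
      at    : Instance
      state : State at
      H-max : 𝓕max Σs at (proj₁ state)
      C-𝓕   : 𝓕 at (proj₂ (proj₂ (proj₂ state)))

  open Valid

  -- No hypothesis bounds `code i` directly. But the program for `F₀` has the instance in memory and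
  -- is charged for it, so its polynomial bounds the instance as well.
  instanceᵇ : (inst : J → Instance) → Small (size ∘ inst) (λ j → encodeInstance Σs (inst j) ∷ [])
  instanceᵇ inst .poly = proj₁ (proj₂ F₀-poly)
  instanceᵇ inst .bound j =
    let (τ , x , _ , b) = proj₂ (proj₂ F₀-poly) (inst j) tt tt in
    ≤-trans (+-monoˡ-≤ 0 (≤-trans (m≤m+n (cells (encodeInstance Σs (inst j))) 1) (n≤1+n _)))
      (≤-trans (env≤time x) b)

  abstract

    -- The decision to emit, the decision to go on and the next state all come from a single scan.
    -- They are computed silently before the output, so only the short middle part `announce` emits.
    stepᶜ : Emitting (size ∘ at)
      (λ u → encodeState (u .at) (u .state) ∷ encodeInstance Σs (u .at) ∷ [])
      (λ u → encodeBool (continues (u .at) (u .state)) ∙ encodeState (u .at) (succ (u .at) (u .state)))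
      (λ u → (if emits (u .at) (u .state) then [ encodeSubset (proj₁ (u .state)) ] else []) ++ [])
    stepᶜ = bindᶜ plan λ s → bindᶜ (announce s) λ s → sndᶜ (varᶜ s (# 1))
      where
      odd returning : Valid → Bool
      odd u = proj₁ (proj₂ (u .state))
      returning u = proj₁ (proj₂ (proj₂ (u .state)))
      env : Valid → Env 2
      env u = encodeState (u .at) (u .state) ∷ encodeInstance Σs (u .at) ∷ []
      next : Valid → Tree
      next u = encodeBool (continues (u .at) (u .state)) ∙ encodeState (u .at) (succ (u .at) (u .state))
      small : Small (size ∘ at) env
      small = (subsetᵇ {ρ = env} (proj₁ ∘ state) +₁ᵇ (boolᵇ {ρ = env} odd +₁ᵇ (boolᵇ {ρ = env} returning +₁ᵇ
        subsetᵇ {ρ = env} (λ u → proj₂ (proj₂ (proj₂ (u .state))))))) +ᵇ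
        instanceᵇ at
      plan : Computable (size ∘ at) env
        (λ u → (encodeBool (emits (u .at) (u .state)) ∙ encodeSubset (proj₁ (u .state))) ∙ next u)
      plan = bindᶜ (scanᶜ (λ u → u .H-max) (λ u → u .C-𝓕) (varᶜ small (# 1))
          (fstᶜ (varᶜ small (# 0))) (fstᶜ (sndᶜ (sndᶜ (varᶜ small (# 0))))) (sndᶜ (sndᶜ (sndᶜ (varᶜ small (# 0))))))
        λ s → let r = varᶜ s (# 0); found = fstᶜ r; st = varᶜ s (# 1); i = varᶜ s (# 2)
                  H = fstᶜ st; d = fstᶜ (sndᶜ st); ret = fstᶜ (sndᶜ (sndᶜ st)) in
          (ifᶜ encodeBool d (notᶜ found) (notᶜ ret) ∙ᶜ H) ∙ᶜ
          (found ∨ᶜ notᶜ (sameᶜ (λ u → proj₁ (u .H-max)) i H (startᶜ i))) ∙ᶜ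
          ifᶜ (λ {u} → encodeState (u .at)) found
            (sndᶜ r ∙ᶜ notᶜ d ∙ᶜ falseᶜ s ∙ᶜ H)
            (parentᶜ (λ u → proj₁ (u .H-max)) i H ∙ᶜ notᶜ d ∙ᶜ trueᶜ s ∙ᶜ H)
      planEnv : Valid → Env 3
      planEnv u = ((encodeBool (emits (u .at) (u .state)) ∙ encodeSubset (proj₁ (u .state))) ∙ next u) ∷ env u
      announce : Small (size ∘ at) planEnv →
        Emitting (size ∘ at) planEnv (const leaf)
          (λ u → if emits (u .at) (u .state) then [ encodeSubset (proj₁ (u .state)) ] else [])
      announce s = caseBoolᶜ {c = λ u → emits (u .at) (u .state)} (fstᶜ (fstᶜ (varᶜ s (# 0))))
        (λ s → reindexᶜ (λ i → i) (λ _ → refl) (λ _ → refl) (λ (_ , eq) → if-cong eq) (leafᶜ s))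
        (λ s → reindexᶜ (λ i → i) (λ _ → refl) (λ _ → refl) (λ (_ , eq) → if-cong eq)
          (emitᶜ (sndᶜ (fstᶜ (varᶜ s (# 2))))))

  walk-max : ∀ {i} a (xs : List (Fin (size i))) → 𝓕max Σs i (proj₁ a) → 𝓕max Σs i (proj₁ (proj₂ a)) →
    𝓕max Σs i (proj₁ (proj₂ (foldlTails (walkStep i) a xs)))
  walk-max a []                 Gm Hm = Hm
  walk-max (G , H , P) (x ∷ xs) Gm Hm with Vec.lookup G x
  ... | true  = walk-max _ xs Gm Hm
  ... | false = walk-max _ xs (pick-max (x ∷ P) Gm) Gm

  parent-max : ∀ i F → 𝓕max Σs i (parent i F)
  parent-max i F = walk-max _ (π i F) (F₀-max i) (F₀-max i)

  scan-max : ∀ {i H C} a Fs → 𝓕max Σs i (proj₂ (proj₂ a)) → All (𝓕max Σs i) Fs →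
    𝓕max Σs i (proj₂ (proj₂ (foldlTails (scanStep i H C) a Fs)))
  scan-max a [] Sm [] = Sm
  scan-max {i} {H} {C} (w , f , S) (F ∷ Fs) Sm (Fm ∷ Fsm)
    with w | (isChild i H F ∧ not (member i F Fs)) ∧ not f
  ... | true  | _     = scan-max {H = H} {C} _ Fs Sm Fsm
  ... | false | true  = scan-max {H = H} {C} _ Fs Fm Fsm
  ... | false | false = scan-max {H = H} {C} _ Fs Sm Fsm

  succ-valid : ∀ i s → 𝓕max Σs i (proj₁ s) →
    𝓕max Σs i (proj₁ (succ i s)) × 𝓕 i (proj₂ (proj₂ (proj₂ (succ i s))))
  succ-valid i (H , d , r , C) Hm
    with scan i H r C | scan-max {H = H} {C} (r , false , H) (neighbours i H) Hm (neighbours-max i H Hm)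
  ... | true  , S | Sm = Sm , proj₁ Hm
  ... | false , S | _  = parent-max i H , proj₁ Hm

  -- Delay and space of the whole run

  -- Bounds the number of steps that the traversal takes before its next output.
  patience : ∀ {i} → State i → ℕ
  patience (_ , false , false , _) = 0
  patience (_ , true  , _     , _) = 1
  patience (_ , false , true  , _) = 2

  patience≤2 : ∀ {i} (s : State i) → patience s ≤ 2
  patience≤2 (_ , false , false , _) = z≤n
  patience≤2 (_ , true  , _     , _) = s≤s z≤n
  patience≤2 (_ , false , true  , _) = ≤-refl

  -- A silent state at odd depth has a further child and enters it, at even depth, where entry
  -- emits. A silent state at even depth is returning, and any move from it leads to odd depth.
  patience-decreases : ∀ i s → emits i s ≡ false → suc (patience (succ i s)) ≤ patience s
  patience-decreases i (H , true , r , C) e with scan i H r C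
  ... | true , _ = ≤-refl
  patience-decreases i (H , false , true , C) e with scan i H true C
  ... | true  , _ = ≤-refl
  ... | false , _ = ≤-refl

  stepLimit : Instance → ℕ
  stepLimit i = ⟦ stepᶜ .cost .poly ⟧ (size i)

  emitted-code : ∀ i s →
    (if emits i s then [ encodeSubset (proj₁ s) ] else []) ++ [] ≡ map encodeSubset (emitted i s)
  emitted-code i s with emits i s
  ... | true  = refl
  ... | false = refl

  -- In the last clause, t is the time already spent since the latest output. The first premise pays
  -- for the steps up to the next output, the second for every later delay.
  Iteration : ∀ i → State i → Tree → List (Subset (size i)) → Set
  Iteration i s w L = ∃[ τ ] encodeInstance Σs i ∷ [] ⊢ stepᶜ .term ↻ encodeState i s ⇓ w ▹ τ
    × outputs τ ≡ map encodeSubset L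
    × space τ ≤ stepLimit i
    × (∀ {t D} → t + suc (patience s) * stepLimit i ≤ D → 4 * stepLimit i ≤ D → All (_≤ D) (delaysFrom t τ))

  body-value : ∀ {i} s {σ c} → continues i s ≡ c →
    encodeState i s ∷ encodeInstance Σs i ∷ [] ⊢ stepᶜ .term ⇓ encodeBool (continues i s) ∙ encodeState i (succ i s) ▹ σ →
    encodeState i s ∷ encodeInstance Σs i ∷ [] ⊢ stepᶜ .term ⇓ encodeBool c ∙ encodeState i (succ i s) ▹ σ
  body-value s refl x = x

  traverse : ∀ {i s L} → 𝓕max Σs i (proj₁ s) → 𝓕 i (proj₂ (proj₂ (proj₂ s))) →
    Traverses i s L → ∃[ w ] Iteration i s w L
  traverse {i} {s} Hm dC (halt e) with stepᶜ .run (valid i s Hm dC) | stepᶜ .cost .bound (valid i s Hm dC)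
  ... | ran {σ} x p q | le = _ , σ ,
    stop (body-value s e x) ,
    trans p (emitted-code i s) , ≤-trans (space≤time σ) q′ ,
    λ {t} {D} t≤D _ → subst (λ τ → All (_≤ D) (delaysFrom t τ)) (++-identityʳ σ)
      (delays-++ {t} {D} σ [] (≤-trans (+-monoʳ-≤ t (≤-trans q′ (m≤m+n _ _))) t≤D) ≤-refl (λ t′ t′≤D → t′≤D ∷ []))
    where
    q′ : time σ ≤ stepLimit i
    q′ = ≤-trans q le
  traverse {i} {s} Hm dC (move {L = L} e T)
    with stepᶜ .run (valid i s Hm dC) | stepᶜ .cost .bound (valid i s Hm dC)
       | traverse (proj₁ (succ-valid i s Hm)) (proj₂ (succ-valid i s Hm)) T
  ... | ran {σ} x p q | le | w , τ , y , r , sp , dl = w , σ ++ τ ,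
    again (body-value s e x) y ,
    trans (outputs-++ σ τ)
      (trans (cong₂ _++_ (trans p (emitted-code i s)) r) (sym (map-++ encodeSubset (emitted i s) L))) ,
    space-++ σ τ (≤-trans (space≤time σ) q′) sp ,
    λ t≤D 4≤D → delay (emits i s) refl t≤D 4≤D
    where
    b = stepLimit i
    q′ : time σ ≤ b
    q′ = ≤-trans q le
    outs≡ : ∀ {c} → emits i s ≡ c → outputs σ ≡ (if c then [ encodeSubset (proj₁ s) ] else []) ++ []
    outs≡ e = trans p (cong (λ c → (if c then [ encodeSubset (proj₁ s) ] else []) ++ []) e)
    delay : ∀ {t D} c → emits i s ≡ c → t + suc (patience s) * b ≤ D → 4 * b ≤ D →
      All (_≤ D) (delaysFrom t (σ ++ τ))
    delay {t} {D} false e t≤D 4≤D =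
      subst (All (_≤ D)) (sym (delays-silent t σ τ (outs≡ e)))
        (dl (≤-trans (≤-reflexive (+-assoc t (time σ) _))
              (≤-trans (+-monoʳ-≤ t (+-mono-≤ q′ (*-monoˡ-≤ b (patience-decreases i s e)))) t≤D)) 4≤D)
    delay {t} true e t≤D 4≤D =
      delays-reset σ τ (λ o → nonempty (trans (sym (outs≡ e)) o))
        (≤-trans (+-monoʳ-≤ t (≤-trans q′ (m≤m+n _ _))) t≤D)
        -- After an output, at most one step limit is left over from the present step, and at most 1
        -- + 2 further steps are needed for the next output or the end: this is the 4.
        (λ t′ t′≤ → dl (≤-trans (+-mono-≤ (≤-trans t′≤ q′) (*-monoˡ-≤ b (s≤s (patience≤2 (succ i s))))) 4≤D) 4≤D)
      where
      nonempty : ∀ {v vs} → _≢_ {A = List Tree} (v ∷ vs) []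
      nonempty ()

  initial : ∀ i → State i
  initial i = F₀ i , false , false , F₀ i

  abstract

    initialᶜ : Computable size (λ i → encodeInstance Σs i ∷ []) (λ i → encodeState i (initial i))
    initialᶜ =
      let s = instanceᵇ (λ i → i); F = startᶜ {inst = λ i → i} (varᶜ s (# 0)) in
      F ∙ᶜ falseᶜ s ∙ᶜ falseᶜ s ∙ᶜ F

  enumerable : (∀ i → ∃[ L ] Traverses i (initial i) L × Unique L × (∀ S → S ∈ₗ L ⇔ 𝓕max Σs i S)) →
    PolyDelayPolySpaceEnumerable Σs (𝓕max Σs)
  enumerable traversal =
    loop (initialᶜ .term) (stepᶜ .term) , total .poly , total .poly , λ i →
      let (L , T , u , complete) = traversal i
          I = initialᶜ .run i
          σ = I .trace
          (w , τ , y , r , sp , dl) = traverse {i} {initial i} {L} (F₀-max i) (proj₁ (F₀-max i)) T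
          D = ⟦ total .poly ⟧ (size i)
      in
      L , w , σ ++ τ , loop (I .eval) y ,
      trans (outputs-++ σ τ) (trans (cong (_++ outputs τ) (I .outs)) r) , u , complete ,
      subst (All (_≤ D)) (sym (delays-silent 0 σ τ (I .outs)))
        -- The initial state is an entry at even depth, of patience 0, so a single step has to be
        -- paid for before the first output.
        (dl {time σ} {D} (≤-trans (+-mono-≤ (I .fast) (*-monoˡ-≤ (stepLimit i) {1} {4} (s≤s z≤n))) (total .bound i))
          (≤-trans (m≤n+m _ (initialᶜ .limit i)) (total .bound i))) ,
      space-++ σ τ (≤-trans (space≤time σ) (≤-trans (I .fast) (≤-trans (m≤m+n _ _) (total .bound i))))
        (≤-trans sp (≤-trans (m≤m+n (stepLimit i) _) (≤-trans (m≤n+m _ (initialᶜ .limit i)) (total .bound i))))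
    where
    total : Bounded size (λ i → initialᶜ .limit i + 4 * stepLimit i)
    total = initialᶜ .cost +ᵇ constᵇ 4 *ᵇ polyᵇ {ρ = λ _ → []} (stepᶜ .cost .poly)

-- Finite sets and lists

∣p∣≡1+∣p∖x∣ : ∀ {n} (p : Subset n) {x} → x ∈ p → ∣ p ∣ ≡ suc ∣ p [ x ]≔ false ∣
∣p∣≡1+∣p∖x∣ (true  ∷ p) here        = refl
∣p∣≡1+∣p∖x∣ (true  ∷ p) (there x∈p) = cong suc (∣p∣≡1+∣p∖x∣ p x∈p)
∣p∣≡1+∣p∖x∣ (false ∷ p) (there x∈p) = ∣p∣≡1+∣p∖x∣ p x∈p

∈-∖⁻ : ∀ {n} (p : Subset n) x {y} → y ∈ p [ x ]≔ false → y ∈ p × y ≢ x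
∈-∖⁻ (b ∷ p) zero    (there y∈) = there y∈ , λ ()
∈-∖⁻ (b ∷ p) (suc x) here       = here , λ ()
∈-∖⁻ (b ∷ p) (suc x) (there y∈) = let (y∈p , y≢x) = ∈-∖⁻ p x y∈ in there y∈p , λ { refl → y≢x refl }

-- Induction on the list, deleting its head from the set. Both the scheme property and
-- prefix-closedness are phrased with the cardinality, whereas the proof splits lists.
Orders-length : ∀ {n} (xs : List (Fin n)) {S : Subset n} → xs Orders S → length xs ≡ ∣ S ∣
Orders-length {n} [] {S} (_ , e) =
  sym (trans (cong ∣_∣ (Empty-unique {p = S} λ (x , x∈S) → case-[] (Equivalence.from (e x) x∈S))) (∣⊥∣≡0 n))
  where
  case-[] : ∀ {x} → ¬ x ∈ₗ ([] {A = Fin n})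
  case-[] ()
Orders-length (x ∷ xs) {S} (x∉xs ∷ u , e) =
  sym (trans (∣p∣≡1+∣p∖x∣ S (Equivalence.to (e x) (here refl)))
    (cong suc (sym (Orders-length xs (u , λ y → mk⇔ (to y) (from y))))))
  where
  to : ∀ y → y ∈ₗ xs → y ∈ S [ x ]≔ false
  to y y∈ = []≔-minimal S y x (λ y≡x → All.lookup x∉xs y∈ (sym y≡x)) (Equivalence.to (e y) (there y∈))
  from : ∀ y → y ∈ S [ x ]≔ false → y ∈ₗ xs
  from y y∈ with ∈-∖⁻ S x y∈
  ... | y∈S , y≢x with Equivalence.from (e y) y∈S
  ...   | here y≡x   = contradiction y≡x y≢x
  ...   | there y∈xs = y∈xs

∈-⋃⁺ : ∀ {n} {x} {xs : List (Fin n)} → x ∈ₗ xs → x ∈ ⋃ (map ⁅_⁆ xs)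
∈-⋃⁺ {x = x} (here refl) = x∈p∪q⁺ (inj₁ (x∈⁅x⁆ x))
∈-⋃⁺ (there x∈) = x∈p∪q⁺ (inj₂ (∈-⋃⁺ x∈))

∈-⋃⁻ : ∀ {n} {x} (xs : List (Fin n)) → x ∈ ⋃ (map ⁅_⁆ xs) → x ∈ₗ xs
∈-⋃⁻ [] x∈ = contradiction x∈ ∉⊥
∈-⋃⁻ (y ∷ xs) x∈ with x∈p∪q⁻ ⁅ y ⁆ _ x∈
... | inj₁ x∈y  = here (x∈⁅y⁆⇒x≡y y x∈y)
... | inj₂ x∈xs = there (∈-⋃⁻ xs x∈xs)

module _ {A : Set} where

  take-length-++ : ∀ (xs : List A) {ys} → take (length xs) (xs ++ ys) ≡ xs
  take-length-++ []       = refl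
  take-length-++ (x ∷ xs) = cong (x ∷_) (take-length-++ xs)

  take-mono : ∀ {m n x} (xs : List A) → m ≤ n → x ∈ₗ take m xs → x ∈ₗ take n xs
  take-mono (x ∷ xs) (s≤s m≤n) (here refl) = here refl
  take-mono (x ∷ xs) (s≤s m≤n) (there x∈)  = there (take-mono xs m≤n x∈)

  position : ∀ (xs : List A) {y ys} → ∃[ j ] toℕ j ≡ length xs × lookup (xs ++ y ∷ ys) j ≡ y
  position []       = zero , refl , refl
  position (x ∷ xs) = let (j , p , q) = position xs in suc j , cong suc p , q

  ∈-ʳ++⁺ : ∀ {x} (xs : List A) {ys} → x ∈ₗ xs ⊎ x ∈ₗ ys → x ∈ₗ xs ʳ++ ys
  ∈-ʳ++⁺ []       (inj₂ x∈)          = x∈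
  ∈-ʳ++⁺ (y ∷ xs) (inj₁ (here refl)) = ∈-ʳ++⁺ xs (inj₂ (here refl))
  ∈-ʳ++⁺ (y ∷ xs) (inj₁ (there x∈))  = ∈-ʳ++⁺ xs (inj₁ x∈)
  ∈-ʳ++⁺ (y ∷ xs) (inj₂ x∈)          = ∈-ʳ++⁺ xs (inj₂ (there x∈))

  -- The list of candidates shrinks with each descent.
  finite⇒Acc : {_<_ : Rel A 0ℓ} → (∀ {x} → ¬ x < x) → (∀ {x y z} → x < y → y < z → x < z) →
    ∀ m (xs : List A) {x} → length xs ≤ m → (∀ {y} → y < x → y ∈ₗ xs) → Acc _<_ x
  finite⇒Acc irr trn zero    []       _  below = acc λ y<x → contradiction (below y<x) λ ()
  finite⇒Acc irr trn (suc m) xs {x} le below = acc λ {y} y<x →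
    let (ys , zs , eq) = ∈-∃++ (below y<x) in
    finite⇒Acc irr trn m (ys ++ zs)
      (s≤s⁻¹ (≤-trans (≤-reflexive (trans (cong suc (length-++ ys)) (trans (sym (+-suc (length ys) (length zs)))
        (sym (trans (cong length eq) (length-++ ys)))))) le))
      λ z<y → remove y ys (subst (_ ∈ₗ_) eq (below (trn z<y y<x))) (λ { refl → irr z<y })
    where
    remove : ∀ {z} y ys {zs} → z ∈ₗ ys ++ y ∷ zs → z ≢ y → z ∈ₗ ys ++ zs
    remove y []       (here z≡y) z≢y = contradiction z≡y z≢y
    remove y []       (there z∈) z≢y = z∈
    remove y (_ ∷ ys) (here p)   z≢y = here p
    remove y (_ ∷ ys) (there z∈) z≢y = there (remove y ys z∈ z≢y)

subsets : ∀ n → List (Subset n)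
subsets zero    = [ [] ]
subsets (suc n) = map (true ∷_) (subsets n) ++ map (false ∷_) (subsets n)

∈-subsets : ∀ {n} (S : Subset n) → S ∈ₗ subsets n
∈-subsets []          = here refl
∈-subsets (true  ∷ S) = ∈-++⁺ˡ (∈-map⁺ (true ∷_) (∈-subsets S))
∈-subsets {suc n} (false ∷ S) = ∈-++⁺ʳ (map (true ∷_) (subsets n)) (∈-map⁺ (false ∷_) (∈-subsets S))

contains-sound : ∀ {n} (xs : List (Fin n)) {S} → contains xs S ≡ true → All (_∈ S) xs
contains-sound []       _ = []
contains-sound (x ∷ xs) {S} e with Vec.lookup S x in l
... | true = lookup⇒[]= x S l ∷ contains-sound xs e

contains-complete : ∀ {n} {xs : List (Fin n)} {S} → All (_∈ S) xs → contains xs S ≡ true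
contains-complete []         = refl
contains-complete (x∈S ∷ xs) rewrite []=⇒lookup x∈S = contains-complete xs

_≟ˢ_ : ∀ {n} → DecidableEquality (Subset n)
_≟ˢ_ = ≡-dec Bool._≟_

-- Solutions and their canonical paths

module Canonical (Σs : SetSystems) (i : SetSystems.Instance Σs)
  (F₀ : Subset (SetSystems.size Σs i)) (F₀-max : 𝓕max Σs i F₀)
  (π : Scheme Σs) (π-scheme : IsOrderingScheme Σs π)
  (neighbours : Subset (SetSystems.size Σs i) → List (Subset (SetSystems.size Σs i)))
  (neighbours-max : ∀ F → 𝓕max Σs i F → All (𝓕max Σs i) (neighbours F))
  (approach : ∀ F₁ F₂ → 𝓕max Σs i F₁ → 𝓕max Σs i F₂ → F₁ ≢ F₂ →
    ∃[ F′ ] F′ ∈ₗ neighbours F₁ × proximity Σs π i F₁ F₂ < proximity Σs π i F′ F₂)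
  (π-closed : PrefixClosed Σs π) where

  open SetSystems Σs
  open Search F₀ (π i) neighbours

  Sol : Subset (size i) → Set
  Sol = 𝓕max Σs i

  Word : Set
  Word = List (Fin (size i))

  ∈-π⁺ : ∀ {S x} → 𝓕 i S → x ∈ S → x ∈ₗ π i S
  ∈-π⁺ {S} {x} d = Equivalence.from (proj₂ (proj₁ (π-scheme i S d)) x)

  ∈-π⁻ : ∀ {S x} → 𝓕 i S → x ∈ₗ π i S → x ∈ S
  ∈-π⁻ {S} {x} d = Equivalence.to (proj₂ (proj₁ (π-scheme i S d)) x)

  length-π : ∀ {S} → 𝓕 i S → length (π i S) ≡ ∣ S ∣
  length-π {S} d = Orders-length (π i S) (proj₁ (π-scheme i S d))

  covered⇒≡ : ∀ {S T} → Sol S → 𝓕 i T → All (_∈ T) (π i S) → S ≡ T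
  covered⇒≡ (d , mx) e all = mx _ e (λ x∈ → All.lookup all (∈-π⁺ d x∈))

  same-sound : ∀ {S T} → Sol S → 𝓕 i T → same S T ≡ true → S ≡ T
  same-sound {S} Sm d e = covered⇒≡ Sm d (contains-sound (π i S) e)

  same-refl : ∀ {S} → 𝓕 i S → same S S ≡ true
  same-refl {S} d = contains-complete {xs = π i S} (All.tabulate (∈-π⁻ d))

  same-≢ : ∀ {S T} → Sol S → 𝓕 i T → S ≢ T → same S T ≡ false
  same-≢ {S} {T} Sm d S≢T with same S T in e
  ... | false = refl
  ... | true  = contradiction (same-sound Sm d e) S≢T

  -- As C lies in `G`, the proximity of `G` to `F` is at least the length of C; that of F′ is
  -- larger. Prefixes are nested, so F′ contains the prefix one longer than C. The element x itself
  -- witnesses that `G` and `F` differ.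
  closer : ∀ {G F C x rest} → Sol G → Sol F → π i F ≡ C ++ x ∷ rest → All (_∈ G) C → x ∉ G →
    ∃[ F′ ] F′ ∈ₗ neighbours G × All (_∈ F′) C × x ∈ F′
  closer {G} {F} {C} {x} {rest} Gm Fm eq C⊆G x∉G
    with approach G F Gm Fm (λ { refl → x∉G (∈-π⁻ (proj₁ Fm) (subst (x ∈ₗ_) (sym eq) (∈-++⁺ʳ C (here refl)))) })
  ... | F′ , F′∈ , lt = F′ , F′∈ , All.tabulate (λ y∈ → inF′ (∈-++⁺ˡ y∈)) , inF′ (∈-++⁺ʳ C (here refl))
    where
    Within : Subset (size i) → ℕ → Set
    Within S k = prefix k (π i F) ⊆ S
    within? : ∀ S → Decidable (Within S)
    within? S k = prefix k (π i F) ⊆? S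
    c<∣F∣ : length C < ∣ F ∣
    c<∣F∣ = ≤-trans (≤-trans (s≤s (m≤m+n (length C) (length rest)))
      (≤-reflexive (trans (sym (+-suc _ _)) (trans (sym (length-++ C)) (cong length (sym eq))))))
      (≤-reflexive (length-π (proj₁ Fm)))
    c-within : Within G (length C)
    c-within y∈ = All.lookup C⊆G (subst (_ ∈ₗ_) (trans (cong (take (length C)) eq) (take-length-++ C))
      (∈-⋃⁻ (take (length C) (π i F)) y∈))
    c<prox : length C < proximity Σs π i F′ F
    c<prox = ≤-trans (s≤s (All.lookup (xs≤max 0 (filter (within? G) (upTo (suc ∣ F ∣))))
      (∈-filter⁺ (within? G) (∈-upTo⁺ (≤-trans c<∣F∣ (n≤1+n _))) c-within))) lt
    prox-within : Within F′ (proximity Σs π i F′ F)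
    prox-within with argmax-sel (λ k → k) 0 (filter (within? F′) (upTo (suc ∣ F ∣)))
    -- The maximum could only be the default 0 if no prefix qualified, but it exceeds the length of
    -- C.
    ... | inj₁ eq = contradiction (≤-trans c<prox (≤-reflexive eq)) λ ()
    ... | inj₂ m∈ = proj₂ (∈-filter⁻ (within? F′) {xs = upTo (suc ∣ F ∣)} m∈)
    inF′ : ∀ {y} → y ∈ₗ C ++ [ x ] → y ∈ F′
    inF′ {y} y∈ = prox-within (∈-⋃⁺ (take-mono (π i F)
      (≤-trans (≤-reflexive (trans (length-++ C) (+-comm (length C) 1))) c<prox)
      (subst (y ∈ₗ_) (sym (trans (cong (take (length (C ++ [ x ]))) (trans eq (sym (++-assoc C [ x ] rest))))
        (take-length-++ (C ++ [ x ])))) y∈)))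

  pick-from : ∀ {P G} Fs → foldlTails (pickStep P) G Fs ≡ G ⊎ foldlTails (pickStep P) G Fs ∈ₗ Fs
  pick-from [] = inj₁ refl
  pick-from {P} {G} (F ∷ Fs) with contains P F
  ... | false with pick-from {P} {G} Fs
  ...   | inj₁ eq = inj₁ eq
  ...   | inj₂ p  = inj₂ (there p)
  pick-from {P} {G} (F ∷ Fs) | true with pick-from {P} {F} Fs
  ...   | inj₁ eq = inj₂ (here eq)
  ...   | inj₂ p  = inj₂ (there p)

  pick-contains : ∀ {P G} Fs → contains P G ≡ true ⊎ (∃[ F ] F ∈ₗ Fs × contains P F ≡ true) →
    contains P (foldlTails (pickStep P) G Fs) ≡ true
  pick-contains [] (inj₁ e) = e
  pick-contains {P} (F ∷ Fs) h with contains P F in e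
  ... | true = pick-contains {P} Fs (inj₁ e)
  pick-contains {P} (F ∷ Fs) (inj₁ h) | false = pick-contains {P} Fs (inj₁ h)
  pick-contains {P} (F ∷ Fs) (inj₂ (_ , there p , h)) | false = pick-contains {P} Fs (inj₂ (_ , p , h))
  pick-contains {P} (F ∷ Fs) (inj₂ (_ , here refl , h)) | false = contradiction (trans (sym h) e) λ ()

  -- On reversed words a shorter prefix is a tail, so the walk becomes a structural recursion and
  -- visibly depends only on the prefix read.
  reached previous : Word → Subset (size i)
  reached []      = F₀
  reached (x ∷ P) = if Vec.lookup (reached P) x then reached P else pick (reached P) (x ∷ P)
  previous []      = F₀
  previous (x ∷ P) = if Vec.lookup (reached P) x then previous P else reached P

  walk-reached : ∀ P xs → foldlTails walkStep (reached P , previous P , P) xs ≡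
    (reached (xs ʳ++ P) , previous (xs ʳ++ P) , xs ʳ++ P)
  walk-reached P []       = refl
  walk-reached P (x ∷ xs) with Vec.lookup (reached P) x | walk-reached (x ∷ P) xs
  ... | true  | ih = ih
  ... | false | ih = ih

  parent-previous : ∀ F → parent F ≡ previous (π i F ʳ++ [])
  parent-previous F = cong (proj₁ ∘ proj₂) (walk-reached [] (π i F))

  lookup-∉ : ∀ {x} {S : Subset (size i)} → Vec.lookup S x ≡ false → x ∉ S
  lookup-∉ e x∈ = contradiction (trans (sym e) ([]=⇒lookup x∈)) λ ()

  -- `closer` supplies a neighbour containing everything read, so the choice succeeds; it is not the
  -- default, which lacks x.
  picked : ∀ {F} P {x rest} → Sol F → Sol (reached P) → All (_∈ reached P) P → x ∉ reached P →
    P ʳ++ x ∷ rest ≡ π i F →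
    pick (reached P) (x ∷ P) ∈ₗ neighbours (reached P) × All (_∈ pick (reached P) (x ∷ P)) (x ∷ P)
  picked P {x} {rest} Fm Gm P⊆G x∉G eq
    with closer Gm Fm (trans (sym eq) (ʳ++-defn P)) (All.tabulate λ y∈ → All.lookup P⊆G (rev y∈)) x∉G
    where
    rev : ∀ {y} → y ∈ₗ reverse P → y ∈ₗ P
    rev y∈ = subst (_ ∈ₗ_) (trans (ʳ++-ʳ++ P) (++-identityʳ P)) (∈-ʳ++⁺ (reverse P) (inj₁ y∈))
  ... | F′ , F′∈ , C⊆F′ , x∈F′
    with pick-contains {x ∷ P} {reached P} (neighbours (reached P))
           (inj₂ (F′ , F′∈ , contains-complete (x∈F′ ∷ All.tabulate λ y∈ → All.lookup C⊆F′ (∈-ʳ++⁺ P (inj₁ y∈)))))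
       | pick-from {x ∷ P} {reached P} (neighbours (reached P))
  ... | c | inj₂ p = p , contains-sound (x ∷ P) c
  ... | c | inj₁ e = contradiction (subst (x ∈_) e (All.lookup (contains-sound (x ∷ P) c) (here refl))) x∉G

  reached-spec : ∀ {F} P {rest} → Sol F → P ʳ++ rest ≡ π i F → Sol (reached P) × All (_∈ reached P) P
  reached-spec []      Fm eq = F₀-max , []
  reached-spec (x ∷ P) Fm eq with reached-spec P Fm eq | Vec.lookup (reached P) x in e
  ... | Gm , P⊆G | true  = Gm , lookup⇒[]= x _ e ∷ P⊆G
  ... | Gm , P⊆G | false =
    let (p , c) = picked P Fm Gm P⊆G (lookup-∉ e) eq in All.lookup (neighbours-max _ Gm) p , c

  reverse-π : ∀ F → (π i F ʳ++ []) ʳ++ [] ≡ π i F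
  reverse-π F = trans (ʳ++-ʳ++ (π i F)) (++-identityʳ (π i F))

  -- Having read all of `π i F`, the path stands at a solution containing F, and F is maximal.
  reached-all : ∀ {F} → Sol F → reached (π i F ʳ++ []) ≡ F
  reached-all {F} Fm with reached-spec (π i F ʳ++ []) Fm (reverse-π F)
  ... | Gm , c = sym (covered⇒≡ Fm (proj₁ Gm) (All.tabulate λ y∈ → All.lookup c (∈-ʳ++⁺ (π i F) (inj₁ y∈))))

  -- Keys and their lexicographic order

  infix 4 _⊢_⊏_ _⋖_

  _≺⟨_⟩_ : Fin (size i) → Word → Fin (size i) → Set
  x ≺⟨ C ⟩ y = proj₁ (π-closed i) (⋃ (map ⁅_⁆ C)) x y

  Extends : Word → Fin (size i) → Set
  Extends C = _⁺ Σs {i} (⋃ (map ⁅_⁆ C))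

  -- Prefix-closedness applied to `π i S` itself, restated for a splitting of the word instead of an
  -- index.
  next-minimal : ∀ {S C x rest} → 𝓕 i S → π i S ≡ C ++ x ∷ rest →
    𝓕 i (⋃ (map ⁅_⁆ C)) × IsMin (λ x y → x ≺⟨ C ⟩ y) (λ y → Extends C y × y ∈ S) x
  next-minimal {S} {C} {x} {rest} d eq =
    subst (λ xs → 𝓕 i (⋃ (map ⁅_⁆ xs))) (trans (cong (take (length C)) eq) (take-length-++ C))
      (proj₂ (π-scheme i S d) (length C) (≤-trans
        (≤-trans (s≤s (m≤m+n (length C) (length rest))) (≤-reflexive (trans (sym (+-suc _ _)) (sym (length-++ C)))))
        (≤-reflexive len))) ,
    subst₂ (λ xs y → IsMin (λ x y → x ≺⟨ xs ⟩ y) (λ z → Extends xs z × z ∈ S) y)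
      (trans (cong (λ m → take m (C ++ x ∷ rest)) j≡) (take-length-++ C)) at-j
      (Equivalence.to (proj₂ (proj₂ (π-closed i)) S d (C ++ x ∷ rest) len) eq j)
    where
    len : length (C ++ x ∷ rest) ≡ ∣ S ∣
    len = trans (cong length (sym eq)) (length-π d)
    j = proj₁ (position C {x} {rest})
    j≡ : toℕ j ≡ length C
    j≡ = proj₁ (proj₂ (position C))
    at-j : lookup (C ++ x ∷ rest) j ≡ x
    at-j = proj₂ (proj₂ (position C))

  -- Unlike in reached, words are read forwards here.

  data _⊢_⊏_ (C : Word) : Word → Word → Set where
    end    : ∀ {b bs} → C ⊢ [] ⊏ b ∷ bs
    differ : ∀ {a as b bs} → 𝓕 i (⋃ (map ⁅_⁆ C)) → Extends C a → Extends C b → a ≺⟨ C ⟩ b → C ⊢ a ∷ as ⊏ b ∷ bs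
    agree  : ∀ {a as bs} → C ++ [ a ] ⊢ as ⊏ bs → C ⊢ a ∷ as ⊏ a ∷ bs

  -- When all three words first differ at the same place, transitivity of the order at C is needed.
  -- It holds only on elements extending C, which is why `differ` stores these memberships.
  ⊏-trans : ∀ {C as bs cs} → C ⊢ as ⊏ bs → C ⊢ bs ⊏ cs → C ⊢ as ⊏ cs
  ⊏-trans end (differ _ _ _ _) = end
  ⊏-trans end (agree _) = end
  ⊏-trans (differ d a b a≺b) (differ _ b′ c b≺c) =
    differ d a c (IsStrictTotalOrder.trans (proj₁ (proj₂ (π-closed i)) _ d) {_ , a} {_ , b} {_ , c} a≺b b≺c)
  ⊏-trans (differ d a b a≺b) (agree _) = differ d a b a≺b
  ⊏-trans (agree _) (differ d b c b≺c) = differ d b c b≺c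
  ⊏-trans (agree p) (agree q) = agree (⊏-trans p q)

  ⊏-irrefl : ∀ {C as} → ¬ C ⊢ as ⊏ as
  ⊏-irrefl (differ d a a′ a≺a) =
    IsStrictTotalOrder.irrefl (proj₁ (proj₂ (π-closed i)) _ d) {_ , a} {_ , a′} refl a≺a
  ⊏-irrefl (agree p) = ⊏-irrefl p

  -- The shortest prefix after which the canonical path no longer moves.

  core : Word → Word
  core []      = []
  core (x ∷ P) = if Vec.lookup (reached P) x then core P else x ∷ P

  core-suffix : ∀ P → ∃[ Q ] P ≡ Q ++ core P
  core-suffix []      = [] , refl
  core-suffix (x ∷ P) with Vec.lookup (reached P) x
  ... | true  = let (Q , eq) = core-suffix P in x ∷ Q , cong (x ∷_) eq
  ... | false = [] , refl

  -- The letters after the core are already in the current solution and cause no move, so the last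
  -- letter of the core is the one that caused the latest move.
  core-last : ∀ P → reached P ≡ F₀ ⊎
    (∃[ x ] ∃[ P′ ] core P ≡ x ∷ P′ × Vec.lookup (reached P′) x ≡ false ×
      previous P ≡ reached P′ × reached P ≡ pick (reached P′) (x ∷ P′))
  core-last []      = inj₁ refl
  core-last (x ∷ P) with Vec.lookup (reached P) x in e
  ... | true  = core-last P
  ... | false = inj₂ (x , P , refl , e , refl , refl)

  -- Once the path stands at a set containing all letters to come, it never moves again.
  core-stays : ∀ {H} xs Q → All (_∈ H) xs → reached Q ≡ H → core (xs ʳ++ Q) ≡ core Q
  core-stays []       Q _ _ = refl
  core-stays (x ∷ xs) Q (x∈ ∷ xs∈) refl = trans (core-stays xs (x ∷ Q) xs∈ reached≡) core≡
    where
    reached≡ : reached (x ∷ Q) ≡ reached Q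
    reached≡ rewrite []=⇒lookup x∈ = refl
    core≡ : core (x ∷ Q) ≡ core Q
    core≡ rewrite []=⇒lookup x∈ = refl

  wordCore : Subset (size i) → Word
  wordCore F = core (π i F ʳ++ [])

  key : Subset (size i) → Word
  key F = reverse (wordCore F)

  _⋖_ : Subset (size i) → Subset (size i) → Set
  S ⋖ T = [] ⊢ key S ⊏ key T

  split-π : ∀ F {Q P} → π i F ʳ++ [] ≡ Q ++ P → P ʳ++ (Q ʳ++ []) ≡ π i F
  split-π F {Q} {P} eq = trans (sym (++-ʳ++ Q)) (trans (cong (_ʳ++ []) (sym eq)) (reverse-π F))

  key-prefix : ∀ H → ∃[ rest ] π i H ≡ key H ++ rest
  key-prefix H with core-suffix (π i H ʳ++ [])
  ... | Q , eq = Q ʳ++ [] , trans (sym (split-π H {Q} eq)) (ʳ++-defn (wordCore H))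

  -- The key of F cut before its last letter: `word` is the reversed rest, `new` the letter at which
  -- the path jumps from the parent to F.
  record Arrival (F : Subset (size i)) : Set where
    field
      word     : Word
      new      : Fin (size i)
      rest     : Word
      order    : word ʳ++ new ∷ rest ≡ π i F
      core≡    : wordCore F ≡ new ∷ word
      parent≡  : parent F ≡ reached word
      missing  : new ∉ reached word
      arrives  : F ≡ pick (reached word) (new ∷ word)

  arrival : ∀ {F} → Sol F → F ≢ F₀ → Arrival F
  arrival {F} Fm F≢F₀ with core-last (π i F ʳ++ []) | core-suffix (π i F ʳ++ [])
  ... | inj₁ e | _ = contradiction (trans (sym (reached-all Fm)) e) F≢F₀
  ... | inj₂ (x , P , c , e , p , r) | Q , s = record
    { order   = split-π F {Q} (trans s (cong (Q ++_) c))
    ; core≡   = c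
    ; parent≡ = trans (parent-previous F) p
    ; missing = lookup-∉ e
    ; arrives = trans (sym (reached-all Fm)) r
    }

  parent-Sol : ∀ {F} → Sol F → F ≢ F₀ → Sol (parent F)
  parent-Sol Fm F≢F₀ = subst Sol (sym parent≡) (proj₁ (reached-spec word Fm order))
    where open Arrival (arrival Fm F≢F₀)

  child∈neighbours : ∀ {F} → Sol F → F ≢ F₀ → F ∈ₗ neighbours (parent F)
  child∈neighbours Fm F≢F₀ = subst₂ (λ F G → F ∈ₗ neighbours G) (sym arrives) (sym parent≡)
    (let (Gm , P⊆G) = reached-spec word Fm order in proj₁ (picked word Fm Gm P⊆G missing order))
    where open Arrival (arrival Fm F≢F₀)

  -- At the first difference between π H and the word along which the
  -- path arrived at H, the greedy choice made by π H is the smaller one,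
  -- because H contains that word. If there is no difference, the path
  -- to H is the same one.

  parent-⋖ : ∀ {F} → Sol F → F ≢ F₀ → parent F ⋖ F
  parent-⋖ {F} Fm F≢F₀ = subst₂ ([] ⊢_⊏_) (cong key (sym parent≡))
    (trans (sym (unfold-reverse new word)) (cong reverse (sym core≡)))
    (go [] (reverse word) (key H) (proj₁ (key-prefix H)) refl (proj₂ (key-prefix H)) refl)
    where
    open Arrival (arrival Fm F≢F₀)
    H = reached word
    Hm : Sol H
    Hm = proj₁ (reached-spec word Fm order)
    word⊆H : All (_∈ H) word
    word⊆H = proj₂ (reached-spec word Fm order)
    -- If `π i H` begins with the word, its remaining letters belong to `H`, where the path already
    -- stands, so they add nothing to the core.
    settled : ∀ {r} → word ʳ++ r ≡ π i H → wordCore H ≡ core word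
    settled {r} eq = trans
      (cong core (trans (cong (_ʳ++ []) (sym eq)) (trans (ʳ++-ʳ++ word) (cong (r ʳ++_) (++-identityʳ word)))))
      (core-stays r word (All.tabulate λ y∈ → ∈-π⁻ (proj₁ Hm) (subst (_ ∈ₗ_) eq (∈-ʳ++⁺ word (inj₂ y∈)))) refl)
    shift : ∀ {ys : Word} C {h xs} → ys ≡ C ++ h ∷ xs → ys ≡ (C ++ [ h ]) ++ xs
    shift C {h} {xs} eq = trans eq (sym (++-assoc C [ h ] xs))
    go : ∀ C ws u r → reverse word ≡ C ++ ws → π i H ≡ key H ++ r → key H ≡ C ++ u → C ⊢ u ⊏ ws ++ [ new ]
    go C []       []      r w p k = end
    go C (f ∷ ws) []      r w p k = end
    -- The word to `H` is exhausted before the key of `H`. Then `π i H` begins with that word and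
    -- `settled` makes the key the core of the word, which cannot be longer than the word.
    go C []       (h ∷ u) r w p k = contradiction too-long (<-irrefl refl)
      where
      C≡ : C ≡ reverse word
      C≡ = sym (trans w (++-identityʳ C))
      too-long : length C < length C
      too-long = begin-strict
        length C                       <⟨ s≤s (m≤m+n (length C) (length u)) ⟩
        suc (length C + length u)      ≡⟨ +-suc (length C) (length u) ⟨
        length C + suc (length u)      ≡⟨ length-++ C ⟨
        length (C ++ h ∷ u)            ≡⟨ cong length k ⟨
        length (key H)                 ≡⟨ length-reverse (wordCore H) ⟩
        length (wordCore H)            ≡⟨ cong length (settled (trans (ʳ++-defn word)
                                            (trans (cong (_++ (h ∷ u ++ r)) (sym C≡)) (trans (sym (++-assoc C (h ∷ u) r))
                                              (trans (cong (_++ r) (sym k)) (sym p)))))) ⟩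
        length (core word)             ≤⟨ m≤n+m _ (length (proj₁ (core-suffix word))) ⟩
        length (proj₁ (core-suffix word)) + length (core word) ≡⟨ length-++ (proj₁ (core-suffix word)) ⟨
        length (proj₁ (core-suffix word) ++ core word) ≡⟨ cong length (proj₂ (core-suffix word)) ⟨
        length word                    ≡⟨ length-reverse word ⟨
        length (reverse word)          ≡⟨ cong length C≡ ⟨
        length C                       ∎
        where open ≤-Reasoning
    go C (f ∷ ws) (h ∷ u) r w p k with h ≟ f
    ... | yes refl = agree (go (C ++ [ h ]) ws u r (shift C w) p (shift C k))
    ... | no h≢f =
      differ 𝓕C (proj₁ (proj₁ minH)) (proj₁ (proj₁ minF)) (proj₂ minH f (proj₁ (proj₁ minF) , f∈H) (h≢f ∘ sym))
      where
      H-next = next-minimal {C = C} {rest = u ++ r} (proj₁ Hm) (trans p (trans (cong (_++ r) k) (++-assoc C (h ∷ u) r)))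
      𝓕C = proj₁ H-next
      minH = proj₂ H-next
      minF = proj₂ (next-minimal {C = C} {rest = ws ++ new ∷ rest} (proj₁ Fm)
        (trans (sym order) (trans (ʳ++-defn word) (trans (cong (_++ new ∷ rest) w) (++-assoc C (f ∷ ws) (new ∷ rest))))))
      f∈H : f ∈ H
      f∈H = All.lookup word⊆H (subst (f ∈ₗ_) (trans (ʳ++-ʳ++ word) (++-identityʳ word))
        (∈-ʳ++⁺ (reverse word) (inj₁ (subst (f ∈ₗ_) (sym w) (∈-++⁺ʳ C (here refl))))))

  ⋖-acc : ∀ S → Acc _⋖_ S
  ⋖-acc S = finite⇒Acc (⊏-irrefl {[]}) ⊏-trans _ (subsets (size i)) ≤-refl λ _ → ∈-subsets _

  -- Keys grow from parent to child, so building subtrees recurses along the converse order, while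
  -- `⋖-acc` serves the way up to the root.
  ⋗-acc : ∀ S → Acc (flip _⋖_) S
  ⋗-acc S = finite⇒Acc (⊏-irrefl {[]}) (flip ⊏-trans) _ (subsets (size i)) ≤-refl λ _ → ∈-subsets _

  -- The traversal of the tree of solutions

  member-true : ∀ {F} Fs → foldlTails (λ b G _ → b ∨ same F G) true Fs ≡ true
  member-true []       = refl
  member-true (_ ∷ Fs) = member-true Fs

  member-sound : ∀ {F Fs} → Sol F → All Sol Fs → member F Fs ≡ true → F ∈ₗ Fs
  member-sound {F} {G ∷ Fs} Fm (Gm ∷ Fsm) e with same F G in s
  ... | true  = here (same-sound Fm (proj₁ Gm) s)
  ... | false = there (member-sound Fm Fsm e)

  member-complete : ∀ {F Fs} → Sol F → F ∈ₗ Fs → member F Fs ≡ true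
  member-complete {F} {_ ∷ Fs} Fm (here refl) rewrite same-refl (proj₁ Fm) = member-true Fs
  member-complete {F} {G ∷ Fs} Fm (there F∈) with same F G
  ... | true  = member-true Fs
  ... | false = member-complete Fm F∈

  isChild-sound : ∀ {H F} → Sol H → Sol F → isChild H F ≡ true → F ≢ F₀ × parent F ≡ H
  isChild-sound {H} {F} Hm Fm e with F ≟ˢ F₀
  ... | yes refl rewrite same-refl (proj₁ F₀-max) = contradiction e λ ()
  ... | no F≢F₀ rewrite same-≢ Fm (proj₁ F₀-max) F≢F₀ =
    F≢F₀ , sym (same-sound Hm (proj₁ (parent-Sol Fm F≢F₀)) e)

  isChild-complete : ∀ {F} → Sol F → F ≢ F₀ → isChild (parent F) F ≡ true
  isChild-complete {F} Fm F≢F₀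
    rewrite same-≢ Fm (proj₁ F₀-max) F≢F₀ = same-refl (proj₁ (parent-Sol Fm F≢F₀))

  -- The duplicate-free list through which `scan` moves without ever storing it.
  kids : Subset (size i) → List (Subset (size i)) → List (Subset (size i))
  kids H []       = []
  kids H (F ∷ Fs) = if isChild H F ∧ not (member F Fs) then F ∷ kids H Fs else kids H Fs

  kids-∈⁻ : ∀ {H K} Fs → K ∈ₗ kids H Fs → K ∈ₗ Fs × isChild H K ≡ true
  kids-∈⁻ {H} (F ∷ Fs) K∈ with isChild H F in c | member F Fs
  ... | false | _     = let (p , q) = kids-∈⁻ Fs K∈ in there p , q
  ... | true  | true  = let (p , q) = kids-∈⁻ Fs K∈ in there p , q
  kids-∈⁻ {H} (F ∷ Fs) (here refl) | true | false = here refl , c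
  kids-∈⁻ {H} (F ∷ Fs) (there K∈)  | true | false = let (p , q) = kids-∈⁻ Fs K∈ in there p , q

  kids-∈⁺ : ∀ {H K Fs} → All Sol Fs → K ∈ₗ Fs → isChild H K ≡ true → K ∈ₗ kids H Fs
  kids-∈⁺ {H} {K} {_ ∷ Fs} (Km ∷ Fsm) (here refl) c rewrite c with member K Fs in e
  ... | true  = kids-∈⁺ Fsm (member-sound Km Fsm e) c
  ... | false = here refl
  kids-∈⁺ {H} {K} {F ∷ Fs} (_ ∷ Fsm) (there K∈) c with isChild H F ∧ not (member F Fs)
  ... | true  = there (kids-∈⁺ Fsm K∈ c)
  ... | false = kids-∈⁺ Fsm K∈ c

  kids-unique : ∀ {H Fs} → All Sol Fs → Unique (kids H Fs)
  kids-unique [] = []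
  kids-unique {H} {F ∷ Fs} (Fm ∷ Fsm) with isChild H F | member F Fs in e
  ... | false | _     = kids-unique Fsm
  ... | true  | true  = kids-unique Fsm
  ... | true  | false =
    All.tabulate (λ { K∈ refl → contradiction (trans (sym e) (member-complete Fm (proj₁ (kids-∈⁻ Fs K∈)))) λ () })
    ∷ kids-unique Fsm

  first : Subset (size i) → List (Subset (size i)) → Bool × Subset (size i)
  first S []      = false , S
  first S (K ∷ _) = true , K

  scan-found : ∀ H C S Fs → foldlTails (scanStep H C) (false , true , S) Fs ≡ (false , true , S)
  scan-found H C S []       = refl
  scan-found H C S (F ∷ Fs) rewrite ∧-zeroʳ (isChild H F ∧ not (member F Fs)) = scan-found H C S Fs

  scan-first : ∀ H C S Fs → foldlTails (scanStep H C) (false , false , S) Fs ≡ (false , first S (kids H Fs))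
  scan-first H C S []       = refl
  scan-first H C S (F ∷ Fs) with isChild H F ∧ not (member F Fs)
  ... | true  = scan-found H C F Fs
  ... | false = scan-first H C S Fs

  kid : ∀ {H C bs} as Fs → kids H Fs ≡ as ++ C ∷ bs → C ∈ₗ Fs × isChild H C ≡ true
  kid as Fs eq = kids-∈⁻ Fs (subst (_ ∈ₗ_) (sym eq) (∈-++⁺ʳ as (here refl)))

  -- Skipping must end exactly at the last occurrence of `C`. Before it, an entry is a non-child, or
  -- occurs again later, or is another child at its last occurrence; none of these ends the
  -- skipping. After it, the scan looks for a first child as in `scan-first`.
  scan-next : ∀ {H C as bs} S Fs → All Sol Fs → kids H Fs ≡ as ++ C ∷ bs →
    proj₂ (foldlTails (scanStep H C) (true , false , S) Fs) ≡ first S bs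
  scan-next {as = []}    S [] [] ()
  scan-next {as = _ ∷ _} S [] [] ()
  scan-next {H} {C} {as} {bs} S (F ∷ Fs) (Fm ∷ Fsm) eq with isChild H F in c | member F Fs in e
  scan-next {H} {C} {[]} {bs} S (F ∷ Fs) (Fm ∷ Fsm) refl | true | false
    rewrite same-refl (proj₁ Fm) = cong proj₂ (scan-first H C S Fs)
  scan-next {H} {C} {a ∷ as} {bs} S (F ∷ Fs) (Fm ∷ Fsm) eq | true | false
    with C∈ ← proj₁ (kid as Fs (proj₂ (∷-injective eq)))
    rewrite same-≢ {C} {F} (All.lookup Fsm C∈) (proj₁ Fm)
              (λ { refl → contradiction (trans (sym e) (member-complete Fm C∈)) λ () })
    = scan-next S Fs Fsm (proj₂ (∷-injective eq))
  scan-next {H} {C} S (F ∷ Fs) (Fm ∷ Fsm) eq | true | true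
    rewrite ∧-zeroʳ (same C F) = scan-next S Fs Fsm eq
  scan-next {H} {C} {as} S (F ∷ Fs) (Fm ∷ Fsm) eq | false | _
    with (C∈ , c′) ← kid as Fs eq
    rewrite same-≢ {C} {F} (All.lookup Fsm C∈) (proj₁ Fm) (λ { refl → contradiction (trans (sym c) c′) λ () })
    = scan-next S Fs Fsm eq

  children : Subset (size i) → List (Subset (size i))
  children H = kids H (neighbours H)

  child⁻ : ∀ {H K} → Sol H → K ∈ₗ children H → Sol K × K ≢ F₀ × parent K ≡ H
  child⁻ {H} Hm K∈ with kids-∈⁻ (neighbours H) K∈
  ... | K∈N , c = let Km = All.lookup (neighbours-max H Hm) K∈N in Km , isChild-sound Hm Km c

  child⁺ : ∀ {K} → Sol K → K ≢ F₀ → K ∈ₗ children (parent K)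
  child⁺ {K} Km K≢F₀ =
    kids-∈⁺ (neighbours-max _ (parent-Sol Km K≢F₀)) (child∈neighbours Km K≢F₀) (isChild-complete Km K≢F₀)

  -- Ancestors in the tree of solutions

  data Ancestor (H : Subset (size i)) : Subset (size i) → Set where
    self : Ancestor H H
    up   : ∀ {S} → Sol S → S ≢ F₀ → Ancestor H (parent S) → Ancestor H S

  ancestor-⋖ : ∀ {H S} → Ancestor H S → H ≡ S ⊎ H ⋖ S
  ancestor-⋖ self = inj₁ refl
  ancestor-⋖ (up Sm S≢F₀ a) with ancestor-⋖ a
  ... | inj₁ refl = inj₂ (parent-⋖ Sm S≢F₀)
  ... | inj₂ p    = inj₂ (⊏-trans p (parent-⋖ Sm S≢F₀))

  -- Both chains climb the same sequence of parents from S. If one stops earlier, at K say, then L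
  -- is the parent of K or lies above it; that parent is also the parent of L, so L would be smaller
  -- than itself.
  siblings-disjoint : ∀ {K L S} → Sol K → K ≢ F₀ → Sol L → L ≢ F₀ → parent K ≡ parent L →
    Ancestor K S → Ancestor L S → K ≡ L
  siblings-disjoint Km K≢ Lm L≢ eq self self = refl
  siblings-disjoint Km K≢ Lm L≢ eq (up _ _ a) (up _ _ b) = siblings-disjoint Km K≢ Lm L≢ eq a b
  siblings-disjoint {K} {L} Km K≢ Lm L≢ eq self (up _ _ b) with ancestor-⋖ b
  ... | inj₁ L≡ = contradiction (subst (_⋖ L) (trans (sym eq) (sym L≡)) (parent-⋖ Lm L≢)) (⊏-irrefl {[]})
  ... | inj₂ p  = contradiction (⊏-trans p (subst (_⋖ L) (sym eq) (parent-⋖ Lm L≢))) (⊏-irrefl {[]})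
  siblings-disjoint {K} {L} Km K≢ Lm L≢ eq (up _ _ a) self with ancestor-⋖ a
  ... | inj₁ K≡ = contradiction (subst (_⋖ K) (trans eq (sym K≡)) (parent-⋖ Km K≢)) (⊏-irrefl {[]})
  ... | inj₂ p  = contradiction (⊏-trans p (subst (_⋖ K) eq (parent-⋖ Km K≢))) (⊏-irrefl {[]})

  ancestor-child : ∀ {H S} → Ancestor H S → S ≡ H ⊎ (∃[ K ] K ∈ₗ children H × Ancestor K S)
  ancestor-child self = inj₁ refl
  ancestor-child (up Sm S≢F₀ a) with ancestor-child a
  ... | inj₁ refl          = inj₂ (_ , child⁺ Sm S≢F₀ , self)
  ... | inj₂ (K , K∈ , a′) = inj₂ (K , K∈ , up Sm S≢F₀ a′)

  child-ancestor : ∀ {H K S} → Sol H → K ∈ₗ children H → Ancestor K S → Ancestor H S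
  child-ancestor {H} Hm K∈ self = let (Km , K≢ , p) = child⁻ Hm K∈ in up Km K≢ (subst (Ancestor H) (sym p) self)
  child-ancestor Hm K∈ (up Sm S≢ a) = up Sm S≢ (child-ancestor Hm K∈ a)

  ancestor-Sol : ∀ {H S} → Sol H → Ancestor H S → Sol S
  ancestor-Sol Hm self       = Hm
  ancestor-Sol Hm (up Sm _ _) = Sm

  -- Climbing to parents strictly decreases the key, so it stops, and it can stop only at `F₀`.
  root-ancestor : ∀ {S} → Acc _⋖_ S → Sol S → Ancestor F₀ S
  root-ancestor {S} (acc rs) Sm with S ≟ˢ F₀
  ... | yes refl = self
  ... | no S≢F₀  = up Sm S≢F₀ (root-ancestor (rs (parent-⋖ Sm S≢F₀)) (parent-Sol Sm S≢F₀))

  -- A continuation: R is the output still to come once the subtree of H is finished, which is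
  -- nothing at the root, and otherwise what the traversal yields on its return to the parent.
  Leaves : Subset (size i) → Bool → List (Subset (size i)) → Set
  Leaves H odd R = (H ≡ F₀ × R ≡ []) ⊎ (H ≢ F₀ × Traverses (parent H , not odd , true , H) R)

  onEntry onExit : Subset (size i) → Bool → List (Subset (size i))
  onEntry H odd = if odd then [] else [ H ]
  onExit H odd  = if odd then [ H ] else []

  before : Subset (size i) → Bool → Bool → List (Subset (size i))
  before H odd returning = if returning then [] else onEntry H odd

  -- A state without a further child is an exit and possibly also an entry; by parity at most one of
  -- the two contributes an output.
  emits-exit : ∀ H odd returning →
    (if (if odd then true else not returning) then [ H ] else []) ≡ before H odd returning ++ onExit H odd
  emits-exit H true  true  = refl
  emits-exit H true  false = refl
  emits-exit H false true  = refl
  emits-exit H false false = refl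

  emits-descent : ∀ H odd returning →
    (if (if odd then false else not returning) then [ H ] else []) ≡ before H odd returning
  emits-descent H true  true  = refl
  emits-descent H true  false = refl
  emits-descent H false true  = refl
  emits-descent H false false = refl

  exit-traverses : ∀ {H odd returning C R} → Sol H → scan H returning C ≡ (false , H) → Leaves H odd R →
    Traverses (H , odd , returning , C) (before H odd returning ++ onExit H odd ++ R)
  exit-traverses {H} {odd} {r} {C} {R} Hm sc lv = go lv
    where
    s = H , odd , r , C
    emitted≡ : emitted s ≡ before H odd r ++ onExit H odd
    emitted≡ rewrite sc = emits-exit H odd r
    go : Leaves H odd R → Traverses s (before H odd r ++ onExit H odd ++ R)
    go (inj₁ (refl , refl)) = subst (Traverses s)
      (trans emitted≡ (cong (before H odd r ++_) (sym (++-identityʳ (onExit H odd)))))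
      (halt continues≡)
      where
      continues≡ : continues s ≡ false
      continues≡ rewrite sc | same-refl (proj₁ Hm) = refl
    go (inj₂ (H≢F₀ , T)) = subst (Traverses s)
      (trans (cong (_++ R) emitted≡) (++-assoc (before H odd r) (onExit H odd) R))
      (move continues≡ (subst (λ s → Traverses s R) succ≡ T))
      where
      continues≡ : continues s ≡ true
      continues≡ rewrite sc | same-≢ Hm (proj₁ F₀-max) H≢F₀ = refl
      succ≡ : (parent H , not odd , true , H) ≡ succ s
      succ≡ rewrite sc = refl

  enter-traverses : ∀ {H odd returning C K R} → scan H returning C ≡ (true , K) →
    Traverses (K , not odd , false , H) R → Traverses (H , odd , returning , C) (before H odd returning ++ R)
  enter-traverses {H} {odd} {r} {C} {K} {R} sc T = subst (Traverses s) (cong (_++ R) emitted≡)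
    (move continues≡ (subst (λ s → Traverses s R) succ≡ T))
    where
    s = H , odd , r , C
    emitted≡ : emitted s ≡ before H odd r
    emitted≡ rewrite sc = emits-descent H odd r
    continues≡ : continues s ≡ true
    continues≡ rewrite sc = refl
    succ≡ : (K , not odd , false , H) ≡ succ s
    succ≡ rewrite sc = refl

  record Subtree (H : Subset (size i)) (odd : Bool) : Set where
    field
      listing   : List (Subset (size i))
      unique    : Unique listing
      sound     : ∀ {S} → S ∈ₗ listing → Ancestor H S
      complete  : ∀ {S} → Ancestor H S → S ∈ₗ listing
      traversed : ∀ {C R} → Leaves H odd R → Traverses (H , odd , false , C) (listing ++ R)

  -- `Ks` are the children of H still to be visited. Stating the situation through the result of
  -- `scan` treats entering H and returning from the preceding child alike.
  record Forest (H : Subset (size i)) (odd : Bool) (Ks : List (Subset (size i))) : Set where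
    field
      listing   : List (Subset (size i))
      unique    : Unique listing
      sound     : ∀ {S} → S ∈ₗ listing → ∃[ K ] K ∈ₗ Ks × Ancestor K S
      complete  : ∀ {K S} → K ∈ₗ Ks → Ancestor K S → S ∈ₗ listing
      traversed : ∀ {returning C R} → scan H returning C ≡ first H Ks → Leaves H odd R →
        Traverses (H , odd , returning , C) (before H odd returning ++ listing ++ onExit H odd ++ R)

  -- The continuation of the subtree of K is the forest of the later siblings, entered by returning
  -- from K; `scan-next` shows that this return finds the first of them.
  forest : ∀ {H odd} → Sol H → (∀ {K} → K ∈ₗ children H → Subtree K (not odd)) →
    ∀ as Ks → children H ≡ as ++ Ks → Forest H odd Ks
  forest Hm sub as [] eq = record
    { listing   = []
    ; unique    = []
    ; sound     = λ ()
    ; complete  = λ ()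
    ; traversed = exit-traverses Hm
    }
  forest {H} {odd} Hm sub as (K ∷ Ks) eq = record
    { listing   = T.listing ++ N.listing
    ; unique    = ++⁺ T.unique N.unique (λ (S∈T , S∈N) → disjoint S∈T (N.sound S∈N))
    ; sound     = sound
    ; complete  = λ { (here refl) a → ∈-++⁺ˡ (T.complete a) ; (there L∈) a → ∈-++⁺ʳ T.listing (N.complete L∈ a) }
    ; traversed = λ {r} {C} {R} sc lv → subst (λ L → Traverses (H , odd , r , C) (before H odd r ++ L))
        (sym (++-assoc T.listing N.listing (onExit H odd ++ R)))
        (enter-traverses sc (T.traversed (inj₂ (K≢F₀ ,
          subst₂ (λ P d → Traverses (P , d , true , K) (N.listing ++ onExit H odd ++ R))
            (sym parent-K) (sym (not-involutive odd))
            (N.traversed (scan-next H (neighbours H) (neighbours-max H Hm) eq) lv)))))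
    }
    where
    K∈ : K ∈ₗ children H
    K∈ = subst (K ∈ₗ_) (sym eq) (∈-++⁺ʳ as (here refl))
    K-Sol = proj₁ (child⁻ Hm K∈)
    K≢F₀ = proj₁ (proj₂ (child⁻ Hm K∈))
    parent-K = proj₂ (proj₂ (child⁻ Hm K∈))
    eq′ = trans eq (sym (++-assoc as [ K ] Ks))
    module T = Subtree (sub K∈)
    module N = Forest (forest Hm sub (as ++ [ K ]) Ks eq′)
    sound : ∀ {S} → S ∈ₗ T.listing ++ N.listing → ∃[ L ] L ∈ₗ K ∷ Ks × Ancestor L S
    sound S∈ with ∈-++⁻ T.listing S∈
    ... | inj₁ p = K , here refl , T.sound p
    ... | inj₂ p = let (L , L∈ , a) = N.sound p in L , there L∈ , a
    K∉Ks : ∀ as → Unique (as ++ K ∷ Ks) → ¬ K ∈ₗ Ks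
    K∉Ks []       (K∉ ∷ _) K∈ = All.lookup K∉ K∈ refl
    K∉Ks (_ ∷ as) (_ ∷ u)  K∈ = K∉Ks as u K∈
    disjoint : ∀ {S} → S ∈ₗ T.listing → ¬ (∃[ L ] L ∈ₗ Ks × Ancestor L S)
    disjoint S∈T (L , L∈ , a) with child⁻ Hm (subst (L ∈ₗ_) (sym eq) (∈-++⁺ʳ as (there L∈)))
    ... | L-Sol , L≢F₀ , parent-L
      with siblings-disjoint K-Sol K≢F₀ L-Sol L≢F₀ (trans parent-K (sym parent-L)) (T.sound S∈T) a
    ...   | refl = K∉Ks as (subst Unique eq (kids-unique (neighbours-max H Hm))) L∈

  root : ∀ {H odd} → Sol H → Forest H odd (children H) → Subtree H odd
  root {H} {odd} Hm N = record
    { listing   = listing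
    ; unique    = ++⁺ (entry-unique odd)
        (++⁺ N.unique (exit-unique odd) (λ (p , q) → H∉N (subst (_∈ₗ N.listing) (exit-∈ odd q) p)))
        (λ (p , q) → entry-disjoint odd p (∈-++⁻ N.listing q))
    ; sound     = sound
    ; complete  = complete
    ; traversed = λ {C} {R} lv → subst (Traverses (H , odd , false , C))
        (trans (cong (onEntry H odd ++_) (sym (++-assoc N.listing (onExit H odd) R)))
          (sym (++-assoc (onEntry H odd) (N.listing ++ onExit H odd) R)))
        (N.traversed (cong proj₂ (scan-first H C H (neighbours H))) lv)
    }
    where
    module N = Forest N
    listing = onEntry H odd ++ N.listing ++ onExit H odd
    -- A descendant through a child K has a key at least that of K in the order, hence larger than
    -- that of `H`.
    H∉N : ¬ H ∈ₗ N.listing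
    H∉N H∈ with N.sound H∈
    ... | K , K∈ , a with child⁻ Hm K∈ | ancestor-⋖ a
    ...   | Km , K≢F₀ , p | inj₁ refl = ⊏-irrefl {[]} (subst (_⋖ K) p (parent-⋖ Km K≢F₀))
    ...   | Km , K≢F₀ , p | inj₂ lt   = ⊏-irrefl {[]} (⊏-trans lt (subst (_⋖ K) p (parent-⋖ Km K≢F₀)))
    exit-∈ : ∀ odd {S} → S ∈ₗ onExit H odd → S ≡ H
    exit-∈ true (here eq) = eq
    entry-∈ : ∀ odd {S} → S ∈ₗ onEntry H odd → S ≡ H
    entry-∈ false (here eq) = eq
    entry-unique : ∀ odd → Unique (onEntry H odd)
    entry-unique true  = []
    entry-unique false = [] ∷ []
    exit-unique : ∀ odd → Unique (onExit H odd)
    exit-unique true  = [] ∷ []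
    exit-unique false = []
    entry-disjoint : ∀ odd {S} → S ∈ₗ onEntry H odd → ¬ (S ∈ₗ N.listing ⊎ S ∈ₗ onExit H odd)
    entry-disjoint odd   p (inj₁ q) = H∉N (subst (_∈ₗ N.listing) (entry-∈ odd p) q)
    entry-disjoint false p (inj₂ ())
    sound : ∀ {S} → S ∈ₗ listing → Ancestor H S
    sound S∈ with ∈-++⁻ (onEntry H odd) S∈
    ... | inj₁ p = subst (Ancestor H) (sym (entry-∈ odd p)) self
    ... | inj₂ q with ∈-++⁻ N.listing q
    ...   | inj₁ p = let (K , K∈ , a) = N.sound p in child-ancestor Hm K∈ a
    ...   | inj₂ p = subst (Ancestor H) (sym (exit-∈ odd p)) self
    H∈ : ∀ odd {L} → H ∈ₗ onEntry H odd ++ L ++ onExit H odd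
    H∈ true {L} = ∈-++⁺ʳ L (here refl)
    H∈ false    = here refl
    complete : ∀ {S} → Ancestor H S → S ∈ₗ listing
    complete a with ancestor-child a
    ... | inj₁ refl          = H∈ odd
    ... | inj₂ (K , K∈ , a′) = ∈-++⁺ʳ (onEntry H odd) (∈-++⁺ˡ (N.complete K∈ a′))

  -- The recursion ends because children have larger keys and there are finitely many sets; the
  -- parity flips with each level.
  subtree : ∀ {H} → Acc (flip _⋖_) H → Sol H → ∀ odd → Subtree H odd
  subtree {H} (acc rs) Hm odd = root Hm (forest Hm
    (λ K∈ → let (Km , K≢F₀ , p) = child⁻ Hm K∈ in
      subtree (rs (subst (_⋖ _) p (parent-⋖ Km K≢F₀))) Km (not odd))
    [] (children H) refl)

  traversal : ∃[ L ] Traverses (F₀ , false , false , F₀) L × Unique L × (∀ S → S ∈ₗ L ⇔ Sol S)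
  traversal = listing , subst (Traverses _) (++-identityʳ listing) (traversed (inj₁ (refl , refl))) , unique ,
    λ S → mk⇔ (λ S∈ → ancestor-Sol F₀-max (sound S∈)) (λ Sm → complete (root-ancestor (⋖-acc S) Sm))
    where open Subtree (subtree (⋗-acc F₀) F₀-max false)

theorem4 : (Σs : SetSystems) (let open SetSystems Σs) →
    (𝓕? : ∀ i → Decidable (𝓕 i)) →
    PolyTimeMembership Σs 𝓕? →
    (F₀ : ∀ i → Subset (size i)) →
    (∀ i → 𝓕max Σs i (F₀ i)) →
    PolyTimeSolution Σs F₀ →
    (π : Scheme Σs) →
    IsOrderingScheme Σs π →
    PolyTimeScheme Σs π →
    ProximitySearchable Σs π →
    PrefixClosed Σs π →
    PolyDelayPolySpaceEnumerable Σs (𝓕max Σs)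
theorem4 Σs _ _ F₀ F₀-max F₀-poly π π-scheme π-poly (neighbours , neighbours-poly , neighbours-max , approach) π-closed =
  Programs.enumerable Σs F₀ F₀-max F₀-poly π π-poly neighbours neighbours-poly neighbours-max
    λ i → Canonical.traversal Σs i (F₀ i) (F₀-max i) π π-scheme (neighbours i) (neighbours-max i) (approach i) π-closed
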